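{- Let $k\ge 3$ and $s\geq 2k$ be integers, and let $\eta>0$. Then there exists a number $c=c(k,s,\eta)>0$ such that for every $A\ge 1$, the number of $\mathbf{a}\in(\mathbb{Z}\setminus\{0\})^s$ with $|\mathbf{a}|\leq A$ for which the equation $a_1x_1^k+\dots+a_sx_s^k=0$ admits an integral solution $\mathbf{x}\in\mathbb{Z}^s$ in the range $0<|\mathbf{x}|\leq c|\mathbf{a}|^{1/(s-k)}$ does not exceed $\eta A^s$.
   Context: $|\mathbf{x}|=\max_j|x_j|$, and similarly for $\mathbf{a}$. -}

module Defs where

open import Level using (0ℓ)
open import Data.Empty using (⊥-elim)
open import Data.Nat as ℕ using (ℕ; zero; suc; z≤n; s≤s)
import Data.Nat.Properties as ℕ
open import Data.Integer as ℤ using (ℤ; +_; 0ℤ)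
import Data.Integer.Properties as ℤ
import Data.Integer.Solver as ℤ
open import Data.Rational as ℚ using (ℚ; mkℚ; 0ℚ; 1ℚ; _+_; _*_; _-_; -_; _≤_; _<_; _/_; ∣_∣; Positive; NonNegative; positive; nonNegative)
open import Data.Rational.Properties as ℚ using (≤-trans; ≤-reflexive; <⇒≤; +-mono-≤; +-monoʳ-≤; +-monoˡ-≤)
open import Data.Rational.Solver using (module +-*-Solver)
open import Data.Rational.Unnormalised as ℚᵘ using (ℚᵘ; mkℚᵘ; *≡*; *≤*)
import Data.Rational.Unnormalised.Properties as ℚᵘ
open import Data.List as List using (List)
import Data.List.Relation.Unary.All as List
open import Data.List.Relation.Unary.Unique.Propositional using (Unique)
open import Data.Vec as Vec using (Vec)
open import Data.Product using (∃-syntax; _×_; _,_)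
open import Data.Sum using (inj₁; inj₂)
open import Relation.Nullary using (yes; no)
open import Relation.Unary using (Pred)
open import Relation.Binary.PropositionalEquality using (_≡_; refl; sym; trans; cong; cong₂; subst; subst₂; module ≡-Reasoning)

∣∣≤ : ∀ {p q ε} → p ≤ q + ε → q ≤ p + ε → ∣ p - q ∣ ≤ ε
∣∣≤ {p} {q} {ε} u v with ℚ.∣p∣≡p∨∣p∣≡-p (p - q)
... | inj₁ e = begin
  ∣ p - q ∣      ≡⟨ e ⟩
  p - q          ≤⟨ +-monoˡ-≤ (- q) u ⟩
  (q + ε) - q    ≡⟨ solve 2 (λ q ε → (q :+ ε) :- q := ε) refl q ε ⟩
  ε              ∎
  where open ℚ.≤-Reasoning
        open +-*-Solver
... | inj₂ e = begin
  ∣ p - q ∣      ≡⟨ e ⟩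
  - (p - q)      ≡⟨ solve 2 (λ p q → :- (p :- q) := q :- p) refl p q ⟩
  q - p          ≤⟨ +-monoˡ-≤ (- p) v ⟩
  (p + ε) - p    ≡⟨ solve 2 (λ q ε → (q :+ ε) :- q := ε) refl p ε ⟩
  ε              ∎
  where open ℚ.≤-Reasoning
        open +-*-Solver

*-mono : ∀ {p q r s} → 0ℚ ≤ p → 0ℚ ≤ s → p ≤ q → r ≤ s → p * r ≤ q * s
*-mono {p} {q} {r} {s} 0≤p 0≤s p≤q r≤s =
  ≤-trans (ℚ.*-monoˡ-≤-nonNeg p {{nonNegative 0≤p}} r≤s)
          (ℚ.*-monoʳ-≤-nonNeg s {{nonNegative 0≤s}} p≤q)

0≤* : ∀ {p q} → 0ℚ ≤ p → 0ℚ ≤ q → 0ℚ ≤ p * q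
0≤* {p} {q} 0≤p 0≤q =
  ≤-trans (≤-reflexive (sym (ℚ.*-zeroˡ q))) (ℚ.*-monoʳ-≤-nonNeg q {{nonNegative 0≤q}} 0≤p)

0<* : ∀ {p q} → 0ℚ < p → 0ℚ < q → 0ℚ < p * q
0<* {p} {q} 0<p 0<q =
  ℚ.≤-<-trans (≤-reflexive (sym (ℚ.*-zeroˡ q))) (ℚ.*-monoˡ-<-pos q {{positive 0<q}} 0<p)

*-close : ∀ {a b c d B C δ} → 0ℚ ≤ δ → 0ℚ ≤ C → ∣ a ∣ ≤ B → ∣ d ∣ ≤ C →
          ∣ a - c ∣ ≤ δ → ∣ b - d ∣ ≤ δ → ∣ a * b - c * d ∣ ≤ δ * (B + C)
*-close {a} {b} {c} {d} {B} {C} {δ} 0≤δ 0≤C a≤B d≤C ac bd = begin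
  ∣ a * b - c * d ∣                        ≡⟨ cong ∣_∣ (solve 4 (λ a b c d → a :* b :- c :* d := a :* (b :- d) :+ (a :- c) :* d) refl a b c d) ⟩
  ∣ a * (b - d) + (a - c) * d ∣            ≤⟨ ℚ.∣p+q∣≤∣p∣+∣q∣ (a * (b - d)) ((a - c) * d) ⟩
  ∣ a * (b - d) ∣ + ∣ (a - c) * d ∣        ≡⟨ cong₂ _+_ (ℚ.∣p*q∣≡∣p∣*∣q∣ a (b - d)) (ℚ.∣p*q∣≡∣p∣*∣q∣ (a - c) d) ⟩
  ∣ a ∣ * ∣ b - d ∣ + ∣ a - c ∣ * ∣ d ∣    ≤⟨ +-mono-≤ (*-mono (ℚ.0≤∣p∣ a) 0≤δ a≤B bd) (*-mono (ℚ.0≤∣p∣ (a - c)) 0≤C ac d≤C) ⟩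
  B * δ + δ * C                            ≡⟨ cong (_+ δ * C) (ℚ.*-comm B δ) ⟩
  δ * B + δ * C                            ≡⟨ ℚ.*-distribˡ-+ δ B C ⟨
  δ * (B + C)                              ∎
  where
  open ℚ.≤-Reasoning
  open +-*-Solver

0<1 : 0ℚ < 1ℚ
0<1 = ℚ.positive⁻¹ 1ℚ

divide : ∀ {ε B} → 0ℚ < ε → 0ℚ < B → ∃[ δ ] (0ℚ < δ × δ * B ≡ ε)
divide {ε} {B} 0<ε 0<B = ε * 1/B , 0<* 0<ε 0<1/B , (begin
  ε * 1/B * B    ≡⟨ ℚ.*-assoc ε 1/B B ⟩
  ε * (1/B * B)  ≡⟨ cong (ε *_) (ℚ.*-inverseˡ B {{B≢0}}) ⟩
  ε * 1ℚ         ≡⟨ ℚ.*-identityʳ ε ⟩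
  ε              ∎)
  where
  open ≡-Reasoning
  B≢0 : ℚ.NonZero B
  B≢0 = ℚ.>-nonZero 0<B
  1/B : ℚ
  1/B = ℚ.1/_ B {{B≢0}}
  0<1/B : 0ℚ < 1/B
  0<1/B = ℚ.positive⁻¹ 1/B {{ℚ.1/pos⇒pos B {{positive 0<B}}}}

/-mono : ∀ {a b c d} → a ℕ.* suc d ℕ.≤ c ℕ.* suc b → + a / suc b ≤ + c / suc d
/-mono {a} {b} {c} {d} h = ℚ.toℚᵘ-cancel-≤ (begin
  ℚ.toℚᵘ (+ a / suc b)  ≃⟨ ℚ.toℚᵘ-fromℚᵘ (mkℚᵘ (+ a) b) ⟩
  mkℚᵘ (+ a) b          ≤⟨ *≤* (subst₂ ℤ._≤_ (ℤ.pos-* a (suc d)) (ℤ.pos-* c (suc b)) (ℤ.+≤+ h)) ⟩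
  mkℚᵘ (+ c) d          ≃⟨ ℚ.toℚᵘ-fromℚᵘ (mkℚᵘ (+ c) d) ⟨
  ℚ.toℚᵘ (+ c / suc d)  ∎)
  where open ℚᵘ.≤-Reasoning

/-suc : ∀ p m → + suc p / suc m ≡ + p / suc m + + 1 / suc m
/-suc p m = ℚ.toℚᵘ-injective (begin
  ℚ.toℚᵘ (+ suc p / suc m)                           ≈⟨ ℚ.toℚᵘ-fromℚᵘ (mkℚᵘ (+ suc p) m) ⟩
  mkℚᵘ (+ suc p) m                                   ≈⟨ *≡* (solve 2 (λ p D → (con (+ 1) :+ p) :* (D :* D) := (p :* D :+ con (+ 1) :* D) :* D) refl (+ p) (+ suc m)) ⟩
  mkℚᵘ (+ p) m ℚᵘ.+ mkℚᵘ (+ 1) m                      ≈⟨ ℚᵘ.+-cong (ℚ.toℚᵘ-fromℚᵘ (mkℚᵘ (+ p) m)) (ℚ.toℚᵘ-fromℚᵘ (mkℚᵘ (+ 1) m)) ⟨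
  ℚ.toℚᵘ (+ p / suc m) ℚᵘ.+ ℚ.toℚᵘ (+ 1 / suc m)      ≈⟨ ℚ.toℚᵘ-homo-+ (+ p / suc m) (+ 1 / suc m) ⟨
  ℚ.toℚᵘ (+ p / suc m + + 1 / suc m)                 ∎)
  where open import Relation.Binary.Reasoning.Setoid ℚᵘ.≃-setoid
        open ℤ.+-*-Solver

ι : ℕ → ℚ
ι n = + n / 1

ι-* : ∀ m n → ι (m ℕ.* n) ≡ ι m * ι n
ι-* m n = ℚ.toℚᵘ-injective (begin
  ℚ.toℚᵘ (ι (m ℕ.* n))               ≈⟨ ℚ.toℚᵘ-fromℚᵘ (mkℚᵘ (+ (m ℕ.* n)) 0) ⟩
  mkℚᵘ (+ (m ℕ.* n)) 0               ≈⟨ *≡* (cong (ℤ._* + 1) (ℤ.pos-* m n)) ⟩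
  mkℚᵘ (+ m) 0 ℚᵘ.* mkℚᵘ (+ n) 0      ≈⟨ ℚᵘ.*-cong (ℚ.toℚᵘ-fromℚᵘ (mkℚᵘ (+ m) 0)) (ℚ.toℚᵘ-fromℚᵘ (mkℚᵘ (+ n) 0)) ⟨
  ℚ.toℚᵘ (ι m) ℚᵘ.* ℚ.toℚᵘ (ι n)      ≈⟨ ℚ.toℚᵘ-homo-* (ι m) (ι n) ⟨
  ℚ.toℚᵘ (ι m * ι n)                 ∎)
  where open import Relation.Binary.Reasoning.Setoid ℚᵘ.≃-setoid

ι-/ : ∀ p m → ι (suc m) * (+ p / suc m) ≡ ι p
ι-/ p m = ℚ.toℚᵘ-injective (begin
  ℚ.toℚᵘ (ι (suc m) * (+ p / suc m))              ≈⟨ ℚ.toℚᵘ-homo-* (ι (suc m)) (+ p / suc m) ⟩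
  ℚ.toℚᵘ (ι (suc m)) ℚᵘ.* ℚ.toℚᵘ (+ p / suc m)     ≈⟨ ℚᵘ.*-cong (ℚ.toℚᵘ-fromℚᵘ (mkℚᵘ (+ suc m) 0)) (ℚ.toℚᵘ-fromℚᵘ (mkℚᵘ (+ p) m)) ⟩
  mkℚᵘ (+ suc m) 0 ℚᵘ.* mkℚᵘ (+ p) m               ≈⟨ *≡* (trans (solve 2 (λ D p → (D :* p) :* con (+ 1) := p :* D) refl (+ suc m) (+ p)) (cong (+ p ℤ.*_) (cong (λ z → + suc z) (sym (ℕ.+-identityʳ m))))) ⟩
  mkℚᵘ (+ p) 0                                    ≈⟨ ℚ.toℚᵘ-fromℚᵘ (mkℚᵘ (+ p) 0) ⟨
  ℚ.toℚᵘ (ι p)                                    ∎)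
  where open import Relation.Binary.Reasoning.Setoid ℚᵘ.≃-setoid
        open ℤ.+-*-Solver

ι-mono : ∀ {m n} → m ℕ.≤ n → ι m ≤ ι n
ι-mono {m} {n} m≤n = /-mono {m} {0} {n} {0} (ℕ.*-monoˡ-≤ 1 m≤n)

0≤/ : ∀ p m → 0ℚ ≤ + p / suc m
0≤/ p m = /-mono {0} {0} {p} {m} z≤n

0<ι : ∀ m → 0ℚ < ι (suc m)
0<ι m = ℚ.<-≤-trans 0<1 (ι-mono {1} {suc m} (s≤s z≤n))

archimedean : ∀ ε → 0ℚ < ε → ∃[ N ] (∀ n → N ℕ.≤ n → + 1 / suc n ≤ ε)
archimedean ε 0<ε = go ε (positive 0<ε)
  where
  go : ∀ ε → Positive ε → ∃[ N ] (∀ n → N ℕ.≤ n → + 1 / suc n ≤ ε)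
  go ε@(mkℚ (+ suc a) b _) _ = b , λ n b≤n →
    subst (+ 1 / suc n ≤_) (ℚ.fromℚᵘ-toℚᵘ ε)
      (/-mono {1} {n} {suc a} {b}
        (ℕ.*-mono-≤ (s≤s (z≤n {a})) (s≤s b≤n)))

-- Real numbers, as Cauchy sequences of rationals.  Statements about reals
-- are only ever made through the relations _≤ᴿ_, _<ᴿ_ and _≃ᴿ_ below, which
-- do not depend on the choice of representing sequence.

record ℝ : Set where
  constructor mkℝ
  field
    seq    : ℕ → ℚ
    cauchy : ∀ ε → 0ℚ < ε →
             ∃[ N ] (∀ m n → N ℕ.≤ m → N ℕ.≤ n → ∣ seq m - seq n ∣ ≤ ε)

open ℝ public

infix 4 _≤ᴿ_ _<ᴿ_ _≃ᴿ_
infixl 7 _*ᴿ_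
infixr 8 _^ᴿ_

_≤ᴿ_ : ℝ → ℝ → Set
x ≤ᴿ y = ∀ ε → 0ℚ < ε → ∃[ N ] (∀ n → N ℕ.≤ n → seq x n ≤ seq y n + ε)

_<ᴿ_ : ℝ → ℝ → Set
x <ᴿ y = ∃[ ε ] (0ℚ < ε × ∃[ N ] (∀ n → N ℕ.≤ n → seq x n + ε ≤ seq y n))

_≃ᴿ_ : ℝ → ℝ → Set
x ≃ᴿ y = x ≤ᴿ y × y ≤ᴿ x

fromℚ : ℚ → ℝ
fromℚ q = mkℝ (λ _ → q) λ ε 0<ε → 0 , λ _ _ _ _ →
  ≤-trans (≤-reflexive (cong ∣_∣ (ℚ.+-inverseʳ q))) (<⇒≤ 0<ε)

fromℕ : ℕ → ℝ
fromℕ n = fromℚ (+ n / 1)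

bounded : ∀ x → ∃[ B ] (0ℚ < B × ∃[ N ] (∀ n → N ℕ.≤ n → ∣ seq x n ∣ ≤ B))
bounded x with cauchy x 1ℚ 0<1
... | N , h = 1ℚ + ∣ seq x N ∣ , 0<B , N , λ n N≤n → begin
  ∣ seq x n ∣                           ≡⟨ cong ∣_∣ (solve 2 (λ a b → a := (a :- b) :+ b) refl (seq x n) (seq x N)) ⟩
  ∣ (seq x n - seq x N) + seq x N ∣     ≤⟨ ℚ.∣p+q∣≤∣p∣+∣q∣ (seq x n - seq x N) (seq x N) ⟩
  ∣ seq x n - seq x N ∣ + ∣ seq x N ∣   ≤⟨ +-monoˡ-≤ ∣ seq x N ∣ (h n N N≤n ℕ.≤-refl) ⟩
  1ℚ + ∣ seq x N ∣                      ∎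
  where
  open ℚ.≤-Reasoning
  open +-*-Solver
  0<B : 0ℚ < 1ℚ + ∣ seq x N ∣
  0<B = ℚ.+-mono-<-≤ 0<1 (ℚ.0≤∣p∣ (seq x N))

_*ᴿ_ : ℝ → ℝ → ℝ
x *ᴿ y = mkℝ (λ n → seq x n * seq y n) *-cauchy
  where
  *-cauchy : ∀ ε → 0ℚ < ε →
    ∃[ N ] (∀ m n → N ℕ.≤ m → N ℕ.≤ n → ∣ seq x m * seq y m - seq x n * seq y n ∣ ≤ ε)
  *-cauchy ε 0<ε =
    let
      B , 0<B , N₁ , hB = bounded x
      C , 0<C , N₂ , hC = bounded y
      δ , 0<δ , eq      = divide 0<ε (ℚ.+-mono-< 0<B 0<C)
      N₃ , hx           = cauchy x δ 0<δ
      N₄ , hy           = cauchy y δ 0<δ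
    in N₁ ℕ.+ N₂ ℕ.+ (N₃ ℕ.+ N₄) , λ m n Nm Nn →
      ≤-trans
        (*-close {seq x m} {seq y m} {seq x n} {seq y n} {B} {C} {δ} (<⇒≤ 0<δ) (<⇒≤ 0<C)
          (hB m (ℕ.m+n≤o⇒m≤o N₁ (ℕ.m+n≤o⇒m≤o (N₁ ℕ.+ N₂) Nm)))
          (hC n (ℕ.m+n≤o⇒n≤o N₁ (ℕ.m+n≤o⇒m≤o (N₁ ℕ.+ N₂) Nn)))
          (hx m n (ℕ.m+n≤o⇒m≤o N₃ (ℕ.m+n≤o⇒n≤o (N₁ ℕ.+ N₂) Nm))
                  (ℕ.m+n≤o⇒m≤o N₃ (ℕ.m+n≤o⇒n≤o (N₁ ℕ.+ N₂) Nn)))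
          (hy m n (ℕ.m+n≤o⇒n≤o N₃ (ℕ.m+n≤o⇒n≤o (N₁ ℕ.+ N₂) Nm))
                  (ℕ.m+n≤o⇒n≤o N₃ (ℕ.m+n≤o⇒n≤o (N₁ ℕ.+ N₂) Nn))))
        (≤-reflexive eq)

_^ᴿ_ : ℝ → ℕ → ℝ
x ^ᴿ zero  = fromℕ 1
x ^ᴿ suc n = x *ᴿ x ^ᴿ n

-- The largest p ≤ n with p ^ d ≤ t, or 0 if there is none.
searchRoot : (d t n : ℕ) → ℕ
searchRoot d t zero = zero
searchRoot d t (suc n) with suc n ℕ.^ d ℕ.≤? t
... | yes _ = suc n
... | no  _ = searchRoot d t n

-- For d ≥ 1 the bound p ≤ t is no restriction, so this is ⌊ t^(1/d) ⌋.
floorRoot : (d t : ℕ) → ℕ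
floorRoot d t = searchRoot d t t

searchRoot-≤ : ∀ d t n → searchRoot (suc d) t n ℕ.^ suc d ℕ.≤ t
searchRoot-≤ d t zero = z≤n
searchRoot-≤ d t (suc n) with suc n ℕ.^ suc d ℕ.≤? t
... | yes le = le
... | no  _  = searchRoot-≤ d t n

searchRoot-< : ∀ d t n → t ℕ.< suc n ℕ.^ suc d →
               t ℕ.< suc (searchRoot (suc d) t n) ℕ.^ suc d
searchRoot-< d t zero lt = lt
searchRoot-< d t (suc n) lt with suc n ℕ.^ suc d ℕ.≤? t
... | yes _  = lt
... | no nle = searchRoot-< d t n (ℕ.≰⇒> nle)

floorRoot-< : ∀ d t → t ℕ.< suc (floorRoot (suc d) t) ℕ.^ suc d
floorRoot-< d t = searchRoot-< d t t
  (ℕ.≤-trans (ℕ.≤-reflexive (sym (ℕ.*-identityʳ (suc t))))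
             (ℕ.*-monoʳ-≤ (suc t) (ℕ.m^n>0 (suc t) d)))

^-distrib-* : ∀ a b d → (a ℕ.* b) ℕ.^ d ≡ a ℕ.^ d ℕ.* b ℕ.^ d
^-distrib-* a b zero    = refl
^-distrib-* a b (suc d) = trans (cong (a ℕ.* b ℕ.*_) (^-distrib-* a b d))
                                (ℕ.[m*n]*[o*p]≡[m*o]*[n*p] a b (a ℕ.^ d) (b ℕ.^ d))

-- ⌊ n^(1/d) (m+1) ⌋ / (m+1), computed as ⌊ (n (m+1)^d)^(1/d) ⌋ / (m+1).
rootSeq : (d n m : ℕ) → ℚ
rootSeq d n m = + floorRoot d (n ℕ.* suc m ℕ.^ d) / suc m

rootSeq-close : ∀ d n i j → rootSeq (suc d) n i ≤ rootSeq (suc d) n j + + 1 / suc j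
rootSeq-close d n i j =
  subst (rootSeq e n i ≤_) (/-suc q j) (/-mono {p} {i} {suc q} {j} claim)
  where
  e = suc d
  I = suc i
  J = suc j
  p = floorRoot e (n ℕ.* I ℕ.^ e)
  q = floorRoot e (n ℕ.* J ℕ.^ e)
  absurd : suc q ℕ.* I ℕ.< p ℕ.* J → suc q ℕ.^ e ℕ.* I ℕ.^ e ℕ.< suc q ℕ.^ e ℕ.* I ℕ.^ e
  absurd lt = begin-strict
    suc q ℕ.^ e ℕ.* I ℕ.^ e         ≡⟨ ^-distrib-* (suc q) I e ⟨
    (suc q ℕ.* I) ℕ.^ e             ≤⟨ ℕ.^-monoˡ-≤ e (ℕ.<⇒≤ lt) ⟩
    (p ℕ.* J) ℕ.^ e                 ≡⟨ ^-distrib-* p J e ⟩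
    p ℕ.^ e ℕ.* J ℕ.^ e             ≤⟨ ℕ.*-monoˡ-≤ (J ℕ.^ e) (searchRoot-≤ d (n ℕ.* I ℕ.^ e) (n ℕ.* I ℕ.^ e)) ⟩
    n ℕ.* I ℕ.^ e ℕ.* J ℕ.^ e       ≡⟨ trans (ℕ.*-assoc n (I ℕ.^ e) (J ℕ.^ e)) (trans (cong (n ℕ.*_) (ℕ.*-comm (I ℕ.^ e) (J ℕ.^ e))) (sym (ℕ.*-assoc n (J ℕ.^ e) (I ℕ.^ e)))) ⟩
    n ℕ.* J ℕ.^ e ℕ.* I ℕ.^ e       <⟨ ℕ.*-monoˡ-< (I ℕ.^ e) {{ℕ.m^n≢0 I e}} (floorRoot-< d (n ℕ.* J ℕ.^ e)) ⟩
    suc q ℕ.^ e ℕ.* I ℕ.^ e         ∎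
    where open ℕ.≤-Reasoning
  claim : p ℕ.* J ℕ.≤ suc q ℕ.* I
  claim with p ℕ.* J ℕ.≤? suc q ℕ.* I
  ... | yes le = le
  ... | no nle = ⊥-elim (ℕ.<-irrefl refl (absurd (ℕ.≰⇒> nle)))

-- n^(1/d) for d ≥ 1 (see root-nonNegative and root-^ below); the value at
-- d = 0 is a dummy.
root : (d n : ℕ) → ℝ
root zero    n = fromℕ 0
root (suc d) n = mkℝ (rootSeq (suc d) n) root-cauchy
  where
  root-cauchy : ∀ ε → 0ℚ < ε →
    ∃[ N ] (∀ i j → N ℕ.≤ i → N ℕ.≤ j → ∣ rootSeq (suc d) n i - rootSeq (suc d) n j ∣ ≤ ε)
  root-cauchy ε 0<ε with archimedean ε 0<ε
  ... | N , h = N , λ i j N≤i N≤j →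
    ∣∣≤ (≤-trans (rootSeq-close d n i j) (+-monoʳ-≤ (rootSeq (suc d) n j) (h j N≤j)))
        (≤-trans (rootSeq-close d n j i) (+-monoʳ-≤ (rootSeq (suc d) n i) (h i N≤i)))

root-nonNegative : ∀ d n → fromℕ 0 ≤ᴿ root (suc d) n
root-nonNegative d n ε 0<ε = 0 , λ m _ →
  +-mono-≤ {0ℚ} {rootSeq (suc d) n m} {0ℚ} {ε}
    (0≤/ (floorRoot (suc d) (n ℕ.* suc m ℕ.^ suc d)) m) (<⇒≤ 0<ε)

infixr 8 _^ℚ_
_^ℚ_ : ℚ → ℕ → ℚ
x ^ℚ zero  = ι 1
x ^ℚ suc d = x * x ^ℚ d

seq-^ : ∀ x d n → seq (x ^ᴿ d) n ≡ seq x n ^ℚ d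
seq-^ x zero    n = refl
seq-^ x (suc d) n = cong (seq x n *_) (seq-^ x d n)

ι-^ : ∀ a d → ι (a ℕ.^ d) ≡ ι a ^ℚ d
ι-^ a zero    = refl
ι-^ a (suc d) = trans (ι-* a (a ℕ.^ d)) (cong (ι a *_) (ι-^ a d))

^ℚ-distrib-* : ∀ a b d → (a * b) ^ℚ d ≡ a ^ℚ d * b ^ℚ d
^ℚ-distrib-* a b zero    = refl
^ℚ-distrib-* a b (suc d) = trans (cong (a * b *_) (^ℚ-distrib-* a b d))
  (solve 4 (λ a b c d → (a :* b) :* (c :* d) := (a :* c) :* (b :* d)) refl a b (a ^ℚ d) (b ^ℚ d))
  where open +-*-Solver

^ℚ-pos : ∀ {a} → 0ℚ < a → ∀ d → 0ℚ < a ^ℚ d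
^ℚ-pos 0<a zero    = 0<1
^ℚ-pos 0<a (suc d) = 0<* 0<a (^ℚ-pos 0<a d)

^ℚ-nonNeg : ∀ {a} → 0ℚ ≤ a → ∀ d → 0ℚ ≤ a ^ℚ d
^ℚ-nonNeg 0≤a zero    = <⇒≤ 0<1
^ℚ-nonNeg 0≤a (suc d) = 0≤* 0≤a (^ℚ-nonNeg 0≤a d)

^ℚ-mono : ∀ {a b} → 0ℚ ≤ a → a ≤ b → ∀ d → a ^ℚ d ≤ b ^ℚ d
^ℚ-mono 0≤a a≤b zero    = ℚ.≤-refl
^ℚ-mono 0≤a a≤b (suc d) =
  *-mono 0≤a (^ℚ-nonNeg (≤-trans 0≤a a≤b) d) a≤b (^ℚ-mono 0≤a a≤b d)

/-^ : ∀ p m d → ι (suc m) ^ℚ d * (+ p / suc m) ^ℚ d ≡ ι (p ℕ.^ d)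
/-^ p m d = trans (sym (^ℚ-distrib-* (ι (suc m)) (+ p / suc m) d))
            (trans (cong (_^ℚ d) (ι-/ p m)) (sym (ι-^ p d)))

scale : ∀ n m d → ι (n ℕ.* suc m ℕ.^ d) ≡ ι (suc m) ^ℚ d * ι n
scale n m d = trans (ι-* n (suc m ℕ.^ d))
  (trans (cong (ι n *_) (ι-^ (suc m) d)) (ℚ.*-comm (ι n) (ι (suc m) ^ℚ d)))

rootSeq-^-≤ : ∀ d n m → rootSeq (suc d) n m ^ℚ suc d ≤ ι n
rootSeq-^-≤ d n m = ℚ.*-cancelˡ-≤-pos (ι (suc m) ^ℚ e) {{positive (^ℚ-pos (0<ι m) e)}}
  (subst₂ _≤_ (sym (/-^ p m e)) (scale n m e)
    (ι-mono {p ℕ.^ e} (searchRoot-≤ d (n ℕ.* suc m ℕ.^ e) (n ℕ.* suc m ℕ.^ e))))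
  where
  e = suc d
  p = floorRoot e (n ℕ.* suc m ℕ.^ e)

rootSeq-^-≥ : ∀ d n m → ι n ≤ (rootSeq (suc d) n m + + 1 / suc m) ^ℚ suc d
rootSeq-^-≥ d n m = subst (λ z → ι n ≤ z ^ℚ e) (/-suc p m)
  (ℚ.*-cancelˡ-≤-pos (ι (suc m) ^ℚ e) {{positive (^ℚ-pos (0<ι m) e)}}
    (subst₂ _≤_ (scale n m e) (sym (/-^ (suc p) m e))
      (ι-mono {n ℕ.* suc m ℕ.^ e} {suc p ℕ.^ e} (ℕ.<⇒≤ (floorRoot-< d (n ℕ.* suc m ℕ.^ e))))))
  where
  e = suc d
  p = floorRoot e (n ℕ.* suc m ℕ.^ e)

increment : ∀ {B} → 0ℚ < B → ∀ d → ∃[ C ] (0ℚ < C ×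
  (∀ r h → 0ℚ ≤ r → r ≤ B → 0ℚ ≤ h → h ≤ 1ℚ → (r + h) ^ℚ d ≤ r ^ℚ d + h * C))
increment 0<B zero = 1ℚ , 0<1 , λ r h _ _ 0≤h _ →
  ≤-trans (≤-reflexive (sym (ℚ.+-identityʳ (ι 1)))) (+-monoʳ-≤ (ι 1) (0≤* 0≤h (<⇒≤ 0<1)))
increment {B} 0<B (suc d) with increment 0<B d
... | C , 0<C , ih =
  B ^ℚ d + (B + 1ℚ) * C ,
  ℚ.+-mono-< (^ℚ-pos 0<B d) (0<* (ℚ.+-mono-< 0<B 0<1) 0<C) ,
  λ r h 0≤r r≤B 0≤h h≤1 → begin
    (r + h) * (r + h) ^ℚ d                       ≤⟨ ℚ.*-monoˡ-≤-nonNeg (r + h) {{nonNegative (+-mono-≤ 0≤r 0≤h)}} (ih r h 0≤r r≤B 0≤h h≤1) ⟩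
    (r + h) * (r ^ℚ d + h * C)                   ≡⟨ solve 4 (λ r h P C → (r :+ h) :* (P :+ h :* C) := r :* P :+ h :* (P :+ (r :+ h) :* C)) refl r h (r ^ℚ d) C ⟩
    r * r ^ℚ d + h * (r ^ℚ d + (r + h) * C)      ≤⟨ +-monoʳ-≤ (r * r ^ℚ d) (ℚ.*-monoˡ-≤-nonNeg h {{nonNegative 0≤h}}
                                                      (+-mono-≤ (^ℚ-mono 0≤r r≤B d) (ℚ.*-monoʳ-≤-nonNeg C {{nonNegative (<⇒≤ 0<C)}} (+-mono-≤ r≤B h≤1)))) ⟩
    r * r ^ℚ d + h * (B ^ℚ d + (B + 1ℚ) * C)     ∎
  where
  open ℚ.≤-Reasoning
  open +-*-Solver

root-^ : ∀ d n → root (suc d) n ^ᴿ suc d ≃ᴿ fromℕ n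
root-^ d n = upper , lower
  where
  e = suc d
  upper : root e n ^ᴿ e ≤ᴿ fromℕ n
  upper ε 0<ε = 0 , λ m _ → begin
    seq (root e n ^ᴿ e) m  ≡⟨ seq-^ (root e n) e m ⟩
    rootSeq e n m ^ℚ e     ≤⟨ rootSeq-^-≤ d n m ⟩
    ι n                    ≡⟨ ℚ.+-identityʳ (ι n) ⟨
    ι n + 0ℚ               ≤⟨ +-monoʳ-≤ (ι n) (<⇒≤ 0<ε) ⟩
    ι n + ε                ∎
    where open ℚ.≤-Reasoning
  lower : fromℕ n ≤ᴿ root e n ^ᴿ e
  lower ε 0<ε =
    let
      B , 0<B , N₁ , hB = bounded (root e n)
      C , 0<C , inc     = increment 0<B e
      δ , 0<δ , eq      = divide 0<ε 0<C
      N₂ , hδ           = archimedean δ 0<δ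
    in N₁ ℕ.+ N₂ , λ m Nm →
      let
        r   = rootSeq e n m
        h   = + 1 / suc m
        0≤r = 0≤/ (floorRoot e (n ℕ.* suc m ℕ.^ e)) m
        r≤B = subst (_≤ B) (ℚ.0≤p⇒∣p∣≡p 0≤r) (hB m (ℕ.m+n≤o⇒m≤o N₁ Nm))
        h≤1 = /-mono {1} {m} {1} {0} (s≤s z≤n)
        h≤δ = hδ m (ℕ.m+n≤o⇒n≤o N₁ Nm)
      in begin
        ι n                           ≤⟨ rootSeq-^-≥ d n m ⟩
        (r + h) ^ℚ e                  ≤⟨ inc r h 0≤r r≤B (0≤/ 1 m) h≤1 ⟩
        r ^ℚ e + h * C                ≤⟨ +-monoʳ-≤ (r ^ℚ e) (ℚ.*-monoʳ-≤-nonNeg C {{nonNegative (<⇒≤ 0<C)}} h≤δ) ⟩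
        r ^ℚ e + δ * C                ≡⟨ cong₂ _+_ (sym (seq-^ (root e n) e m)) eq ⟩
        seq (root e n ^ᴿ e) m + ε     ∎
    where open ℚ.≤-Reasoning

‖_‖ : ∀ {s} → Vec ℤ s → ℕ
‖ x ‖ = Vec.foldr′ ℕ._⊔_ 0 (Vec.map ℤ.∣_∣ x)

diagonalForm : ∀ {s} → ℕ → Vec ℤ s → Vec ℤ s → ℤ
diagonalForm k a x = Vec.foldr′ ℤ._+_ 0ℤ (Vec.zipWith (λ aⱼ xⱼ → aⱼ ℤ.* xⱼ ℤ.^ k) a x)

-- The number of elements satisfying P does not exceed y.  As P need not be
-- decidable, this bounds every finite repetition-free list of such elements.
AtMost : ∀ {A : Set} → ℝ → Pred A 0ℓ → Set
AtMost y P = ∀ xs → Unique xs → List.All P xs → fromℕ (List.length xs) ≤ᴿ y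

{-# OPTIONS --safe #-}

-- Write d = s − k, so d ≥ k.  Suppose that the equation with coefficients a, where
-- |a| ≤ M, has a nonzero solution x; dividing by the gcd we may take x primitive.
-- Let X = |x|, attained at xⱼ, with Xᵏ ≤ M.  By Bézout every 0 ≤ n < XᵏM is the value
-- at x of some coefficient vector u(x, n), and reducing modulo Xᵏ in the coordinates
-- and compensating at j makes |u(x, n)| ≪ M.  As the form with coefficients
-- a + u(x, n) takes the value n at x, the pair (x, a + u(x, n)) determines a and n.
-- There are ≪ Xˢ⁻¹ vectors x, so the number of a belonging to a given X is
-- ≪ Xˢ⁻¹Mˢ / (XᵏM) = Xᵈ⁻¹Mˢ⁻¹.  Summing over X ≤ N, where N ≤ c M^(1/d), gives
-- ≪ Nᵈ Mˢ⁻¹ ≤ cᵈMˢ.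

module Submission where

open import Defs using (ℝ; fromℕ; fromℚ; seq; _≤ᴿ_; _<ᴿ_; _*ᴿ_; _^ᴿ_; root; ‖_‖; diagonalForm; AtMost;
  floorRoot; floorRoot-<; searchRoot-≤; ^-distrib-*; ι; ι-*; ι-/; ι-^; ι-mono; 0<ι; 0≤/; /-mono; /-suc; 0≤*; *-mono;
  _^ℚ_; ^ℚ-mono; ^ℚ-pos; ^ℚ-nonNeg; ^ℚ-distrib-*; seq-^; rootSeq; rootSeq-^-≤; bounded; increment; divide; archimedean)
open import Data.Nat using (ℕ; _≤_; _<_; _*_; _∸_; zero; suc; _+_; _^_; _⊔_; _/_; z≤n; s≤s; NonZero; ≢-nonZero; ≢-nonZero⁻¹; >-nonZero; >-nonZero⁻¹)
import Data.Nat.Properties as ℕ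
import Data.Nat.DivMod as ℕ
open import Data.Nat.Divisibility as ∣ using (_∣_; divides)
open import Data.Nat.GCD using (gcd; gcd[m,n]∣m; gcd[m,n]∣n; gcd-GCD; c*gcd[m,n]≡gcd[cm,cn]; gcd[m,n]≡0⇒m≡0; module Bézout)
open import Data.Nat.Tactic.RingSolver using () renaming (solve-∀ to solve-∀-ℕ)
open import Data.Integer as ℤ using (ℤ; 0ℤ; 1ℤ; +_; ∣_∣; _◃_; sign)
import Data.Integer.Properties as ℤ
import Data.Integer.DivMod as ℤ
open import Data.Integer.Tactic.RingSolver using (solve-∀)
import Algebra.Properties.AbelianGroup ℤ.+-0-abelianGroup as ℤ-group
open import Data.Rational as ℚ using (ℚ; 0ℚ; 1ℚ; ½)
import Data.Rational.Properties as ℚ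
import Data.Rational.Solver as ℚ
open import Data.Sign using (Sign)
open import Data.Fin as Fin using (Fin)
import Data.Fin.Properties as Fin
open import Data.List as List using (List; []; _∷_)
open import Data.List.Membership.Propositional.Properties using (∈-lookup)
import Data.List.Relation.Unary.All as Allᴸ
open import Data.List.Relation.Unary.AllPairs using ([]; _∷_)
open import Data.List.Relation.Unary.Unique.Propositional using (Unique)
open import Data.List.Relation.Binary.Sublist.Propositional using (_⊆_; []; _∷ʳ_; _∷_)
open import Data.List.Relation.Binary.Sublist.Propositional.Properties using (All-resp-⊆)
open import Data.Vec as Vec using (Vec; []; _∷_; lookup; _[_]%=_; _[_]≔_)
import Data.Vec.Properties as Vec
open import Data.Vec.Relation.Unary.All using (All)
open import Data.Empty using (⊥-elim)
open import Data.Product using (∃-syntax; ∃₂; _×_; _,_; proj₁; proj₂)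
open import Data.Sum using (_⊎_; inj₁; inj₂)
open import Function using (Injective)
open import Relation.Binary.PropositionalEquality using (_≡_; _≢_; refl; sym; trans; cong; cong₂; subst; module ≡-Reasoning)

private variable
  s : ℕ

-- Powers, diagonal forms and the maximum norm.

^-distribʳ-* : ∀ k x y → (x ℤ.* y) ℤ.^ k ≡ x ℤ.^ k ℤ.* y ℤ.^ k
^-distribʳ-* zero    x y = refl
^-distribʳ-* (suc k) x y = trans (cong (λ f → x ℤ.* y ℤ.* f) (^-distribʳ-* k x y))
                                 (interchange x y (x ℤ.^ k) (y ℤ.^ k))
  where
  interchange : ∀ x y u v → x ℤ.* y ℤ.* (u ℤ.* v) ≡ x ℤ.* u ℤ.* (y ℤ.* v)
  interchange = solve-∀

abs-^ : ∀ x k → ∣ x ℤ.^ k ∣ ≡ ∣ x ∣ ^ k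
abs-^ x zero    = refl
abs-^ x (suc k) = trans (ℤ.abs-* x (x ℤ.^ k)) (cong (∣ x ∣ *_) (abs-^ x k))

-- At 0 this is 1, so that `∣unit∣` holds without a case distinction.
unit : ℤ → ℤ
unit i = sign i ◃ 1

unit-* : ∀ i → unit i ℤ.* i ≡ + ∣ i ∣
unit-* (+ n)        = ℤ.*-identityˡ (+ n)
unit-* ℤ.-[1+ n ]   = cong (λ m → + suc m) (ℕ.+-identityʳ n)

∣unit∣ : ∀ i → ∣ unit i ∣ ≡ 1
∣unit∣ i = ℤ.abs-◃ (sign i) 1

∣head∣≤‖‖ : ∀ x (xs : Vec ℤ s) → ∣ x ∣ ≤ ‖ x ∷ xs ‖
∣head∣≤‖‖ x xs = ℕ.m≤m⊔n ∣ x ∣ ‖ xs ‖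

‖tail‖≤‖‖ : ∀ x (xs : Vec ℤ s) → ‖ xs ‖ ≤ ‖ x ∷ xs ‖
‖tail‖≤‖‖ x xs = ℕ.m≤n⊔m ∣ x ∣ ‖ xs ‖

module _ (k : ℕ) where

  form-+ : (a b x : Vec ℤ s) →
    diagonalForm k (Vec.zipWith ℤ._+_ a b) x ≡ diagonalForm k a x ℤ.+ diagonalForm k b x
  form-+ []       []       []       = refl
  form-+ (a ∷ as) (b ∷ bs) (x ∷ xs) =
    trans (cong (λ f → (a ℤ.+ b) ℤ.* x ℤ.^ k ℤ.+ f) (form-+ as bs xs)) (rearrange a b (x ℤ.^ k) _ _)
    where
    rearrange : ∀ a b w f g →
      (a ℤ.+ b) ℤ.* w ℤ.+ (f ℤ.+ g) ≡ (a ℤ.* w ℤ.+ f) ℤ.+ (b ℤ.* w ℤ.+ g)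
    rearrange = solve-∀

  form-*ˡ : ∀ c (a x : Vec ℤ s) → diagonalForm k (Vec.map (c ℤ.*_) a) x ≡ c ℤ.* diagonalForm k a x
  form-*ˡ c []       []       = sym (ℤ.*-zeroʳ c)
  form-*ˡ c (a ∷ as) (x ∷ xs) =
    trans (cong (λ f → c ℤ.* a ℤ.* x ℤ.^ k ℤ.+ f) (form-*ˡ c as xs)) (rearrange c a (x ℤ.^ k) _)
    where
    rearrange : ∀ c a w f → c ℤ.* a ℤ.* w ℤ.+ c ℤ.* f ≡ c ℤ.* (a ℤ.* w ℤ.+ f)
    rearrange = solve-∀

  form-*ʳ : ∀ c (a x : Vec ℤ s) →
    diagonalForm k a (Vec.map (c ℤ.*_) x) ≡ c ℤ.^ k ℤ.* diagonalForm k a x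
  form-*ʳ c []       []       = sym (ℤ.*-zeroʳ (c ℤ.^ k))
  form-*ʳ c (a ∷ as) (x ∷ xs) =
    trans (cong₂ (λ w f → a ℤ.* w ℤ.+ f) (^-distribʳ-* k c x) (form-*ʳ c as xs))
          (rearrange a (c ℤ.^ k) (x ℤ.^ k) _)
    where
    rearrange : ∀ a c w f → a ℤ.* (c ℤ.* w) ℤ.+ c ℤ.* f ≡ c ℤ.* (a ℤ.* w ℤ.+ f)
    rearrange = solve-∀

  form-%= : ∀ (a x : Vec ℤ s) j e →
    diagonalForm k (a [ j ]%= (ℤ._+ e)) x ≡ diagonalForm k a x ℤ.+ e ℤ.* lookup x j ℤ.^ k
  form-%= (a ∷ as) (x ∷ xs) Fin.zero e = rearrange a e (x ℤ.^ k) _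
    where
    rearrange : ∀ a e w f → (a ℤ.+ e) ℤ.* w ℤ.+ f ≡ (a ℤ.* w ℤ.+ f) ℤ.+ e ℤ.* w
    rearrange = solve-∀
  form-%= (a ∷ as) (x ∷ xs) (Fin.suc j) e =
    trans (cong (λ f → a ℤ.* x ℤ.^ k ℤ.+ f) (form-%= as xs j e)) (sym (ℤ.+-assoc (a ℤ.* x ℤ.^ k) _ _))

  ∣form∣≤ : ∀ (a x : Vec ℤ s) → ∣ diagonalForm k a x ∣ ≤ s * (‖ a ‖ * ‖ x ‖ ^ k)
  ∣form∣≤ []       []       = z≤n
  ∣form∣≤ {suc s} (a ∷ as) (x ∷ xs) = begin
    ∣ a ℤ.* x ℤ.^ k ℤ.+ f ∣                  ≤⟨ ℤ.∣i+j∣≤∣i∣+∣j∣ (a ℤ.* x ℤ.^ k) f ⟩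
    ∣ a ℤ.* x ℤ.^ k ∣ + ∣ f ∣                ≡⟨ cong (_+ ∣ f ∣) (trans (ℤ.abs-* a (x ℤ.^ k)) (cong (∣ a ∣ *_) (abs-^ x k))) ⟩
    ∣ a ∣ * ∣ x ∣ ^ k + ∣ f ∣                ≤⟨ ℕ.+-mono-≤ (bound (∣head∣≤‖‖ a as) (∣head∣≤‖‖ x xs))
                                                  (ℕ.≤-trans (∣form∣≤ as xs) (ℕ.*-monoʳ-≤ s (bound (‖tail‖≤‖‖ a as) (‖tail‖≤‖‖ x xs)))) ⟩
    suc s * (‖ a ∷ as ‖ * ‖ x ∷ xs ‖ ^ k)    ∎
    where
    open ℕ.≤-Reasoning
    f = diagonalForm k as xs
    bound : ∀ {m n p q} → m ≤ p → n ≤ q → m * n ^ k ≤ p * q ^ k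
    bound m≤p n≤q = ℕ.*-mono-≤ m≤p (ℕ.^-monoˡ-≤ k n≤q)

‖‖-+ : ∀ (a b : Vec ℤ s) → ‖ Vec.zipWith ℤ._+_ a b ‖ ≤ ‖ a ‖ + ‖ b ‖
‖‖-+ []       []       = z≤n
‖‖-+ (a ∷ as) (b ∷ bs) = ℕ.⊔-lub
  (ℕ.≤-trans (ℤ.∣i+j∣≤∣i∣+∣j∣ a b) (ℕ.+-mono-≤ (∣head∣≤‖‖ a as) (∣head∣≤‖‖ b bs)))
  (ℕ.≤-trans (‖‖-+ as bs) (ℕ.+-mono-≤ (‖tail‖≤‖‖ a as) (‖tail‖≤‖‖ b bs)))

‖‖-* : ∀ c (x : Vec ℤ s) → ‖ Vec.map (c ℤ.*_) x ‖ ≡ ∣ c ∣ * ‖ x ‖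
‖‖-* c []       = sym (ℕ.*-zeroʳ ∣ c ∣)
‖‖-* c (x ∷ xs) = trans (cong₂ _⊔_ (ℤ.abs-* c x) (‖‖-* c xs))
                        (sym (ℕ.*-distribˡ-⊔ ∣ c ∣ ∣ x ∣ ‖ xs ‖))

‖‖-%= : ∀ (a : Vec ℤ s) j e → ‖ a [ j ]%= (ℤ._+ e) ‖ ≤ ‖ a ‖ + ∣ e ∣
‖‖-%= (a ∷ as) Fin.zero    e = ℕ.⊔-lub
  (ℕ.≤-trans (ℤ.∣i+j∣≤∣i∣+∣j∣ a e) (ℕ.+-monoˡ-≤ ∣ e ∣ (∣head∣≤‖‖ a as)))
  (ℕ.≤-trans (‖tail‖≤‖‖ a as) (ℕ.m≤m+n _ ∣ e ∣))
‖‖-%= (a ∷ as) (Fin.suc j) e = ℕ.⊔-lub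
  (ℕ.≤-trans (∣head∣≤‖‖ a as) (ℕ.m≤m+n _ ∣ e ∣))
  (ℕ.≤-trans (‖‖-%= as j e) (ℕ.+-monoˡ-≤ ∣ e ∣ (‖tail‖≤‖‖ a as)))

‖‖-≔ : ∀ (x : Vec ℤ s) j {y n} → ‖ x ‖ ≤ n → ∣ y ∣ ≤ n → ‖ x [ j ]≔ y ‖ ≤ n
‖‖-≔ (x ∷ xs) Fin.zero    x≤n y≤n = ℕ.⊔-lub y≤n (ℕ.m⊔n≤o⇒n≤o _ _ x≤n)
‖‖-≔ (x ∷ xs) (Fin.suc j) x≤n y≤n =
  ℕ.⊔-lub (ℕ.m⊔n≤o⇒m≤o _ _ x≤n) (‖‖-≔ xs j (ℕ.m⊔n≤o⇒n≤o _ _ x≤n) y≤n)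

‖‖-lub : ∀ {n} {A : Set} {f : A → ℤ} → (∀ x → ∣ f x ∣ ≤ n) → (xs : Vec A s) → ‖ Vec.map f xs ‖ ≤ n
‖‖-lub h []       = z≤n
‖‖-lub h (x ∷ xs) = ℕ.⊔-lub (h x) (‖‖-lub h xs)

argmax : ∀ (x : Vec ℤ (suc s)) → ∃[ j ] ∣ lookup x j ∣ ≡ ‖ x ‖
argmax (x ∷ []) = Fin.zero , sym (ℕ.⊔-identityʳ ∣ x ∣)
argmax (x ∷ xs@(_ ∷ _)) with ℕ.⊔-sel ∣ x ∣ ‖ xs ‖ | argmax xs
... | inj₁ e | _      = Fin.zero , sym e
... | inj₂ e | j , e′ = Fin.suc j , trans e′ (sym e)

+-cancelʳ : ∀ (a b c : Vec ℤ s) → Vec.zipWith ℤ._+_ a c ≡ Vec.zipWith ℤ._+_ b c → a ≡ b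
+-cancelʳ []       []       []       _  = refl
+-cancelʳ (a ∷ as) (b ∷ bs) (c ∷ cs) eq =
  cong₂ _∷_ (ℤ-group.∙-cancelʳ c a b (cong Vec.head eq)) (+-cancelʳ as bs cs (cong Vec.tail eq))

-- Content and Bézout identities for powers.

content : Vec ℤ s → ℕ
content = Vec.foldr′ (λ x → gcd ∣ x ∣) 0

-- Multiply the relation for `k` by `p a + r b = 1`: every term of the product except `P p aᵏ⁺¹`
-- contains `b`.
coprime-^ : ∀ k {p r a b} → p ℤ.* a ℤ.+ r ℤ.* b ≡ 1ℤ → ∃₂ λ P Q → P ℤ.* a ℤ.^ k ℤ.+ Q ℤ.* b ≡ 1ℤ
coprime-^ zero    {b = b} _ = 1ℤ , 0ℤ , refl
coprime-^ (suc k) {p} {r} {a} {b} eq with coprime-^ k {p} {r} {a} {b} eq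
... | P , Q , ih = P ℤ.* p , P ℤ.* a ℤ.^ k ℤ.* r ℤ.+ Q ℤ.* p ℤ.* a ℤ.+ Q ℤ.* r ℤ.* b ,
  trans (expand P Q p r a b (a ℤ.^ k)) (cong₂ ℤ._*_ ih eq)
  where
  expand : ∀ P Q p r a b w →
    P ℤ.* p ℤ.* (a ℤ.* w) ℤ.+ (P ℤ.* w ℤ.* r ℤ.+ Q ℤ.* p ℤ.* a ℤ.+ Q ℤ.* r ℤ.* b) ℤ.* b ≡
    (P ℤ.* w ℤ.+ Q ℤ.* b) ℤ.* (p ℤ.* a ℤ.+ r ℤ.* b)
  expand = solve-∀

bézoutℤ : ∀ m n → ∃₂ λ p r → p ℤ.* m ℤ.+ r ℤ.* n ≡ + gcd ∣ m ∣ ∣ n ∣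
bézoutℤ m n = from (Bézout.identity (gcd-GCD ∣ m ∣ ∣ n ∣))
  where
  toℤ : ∀ {g} x m y n → g + y * ∣ n ∣ ≡ x * ∣ m ∣ →
    + x ℤ.* unit m ℤ.* m ℤ.+ ℤ.- (+ y ℤ.* unit n) ℤ.* n ≡ + g
  toℤ {g} x m y n eq = begin
    + x ℤ.* unit m ℤ.* m ℤ.+ ℤ.- (+ y ℤ.* unit n) ℤ.* n      ≡⟨ regroup (+ x) (unit m) m (+ y) (unit n) n ⟩
    + x ℤ.* (unit m ℤ.* m) ℤ.- + y ℤ.* (unit n ℤ.* n)        ≡⟨ cong₂ (λ u v → + x ℤ.* u ℤ.- + y ℤ.* v) (unit-* m) (unit-* n) ⟩
    + x ℤ.* + ∣ m ∣ ℤ.- + y ℤ.* + ∣ n ∣                      ≡⟨ cong₂ ℤ._-_ (ℤ.pos-* x ∣ m ∣) (ℤ.pos-* y ∣ n ∣) ⟨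
    + (x * ∣ m ∣) ℤ.- + (y * ∣ n ∣)                          ≡⟨ cong (λ z → + z ℤ.- + (y * ∣ n ∣)) eq ⟨
    + g ℤ.+ + (y * ∣ n ∣) ℤ.- + (y * ∣ n ∣)                  ≡⟨ cancel (+ g) (+ (y * ∣ n ∣)) ⟩
    + g                                                      ∎
    where
    open ≡-Reasoning
    regroup : ∀ x u m y v n → x ℤ.* u ℤ.* m ℤ.+ ℤ.- (y ℤ.* v) ℤ.* n ≡ x ℤ.* (u ℤ.* m) ℤ.- y ℤ.* (v ℤ.* n)
    regroup = solve-∀
    cancel : ∀ g z → g ℤ.+ z ℤ.- z ≡ g
    cancel = solve-∀
  from : ∀ {g} → Bézout.Identity g ∣ m ∣ ∣ n ∣ → ∃₂ λ p r → p ℤ.* m ℤ.+ r ℤ.* n ≡ + g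
  from (Bézout.+- x y eq) = + x ℤ.* unit m , ℤ.- (+ y ℤ.* unit n) , toℤ x m y n eq
  from (Bézout.-+ x y eq) = ℤ.- (+ x ℤ.* unit m) , + y ℤ.* unit n ,
    trans (ℤ.+-comm (ℤ.- (+ x ℤ.* unit m) ℤ.* m) _) (toℤ y n x m eq)

∣-quotient : ∀ {g} m → g ∣ ∣ m ∣ → ∃[ a ] m ≡ + g ℤ.* a
∣-quotient {g} m (divides q eq) = sign m ◃ q , (begin
  m                             ≡⟨ ℤ.◃-inverse m ⟨
  sign m ◃ ∣ m ∣                ≡⟨ cong (sign m ◃_) (trans eq (ℕ.*-comm q g)) ⟩
  sign m ◃ (g * q)              ≡⟨ ℤ.◃-distrib-* Sign.+ (sign m) g q ⟩
  (Sign.+ ◃ g) ℤ.* (sign m ◃ q)  ≡⟨ cong (ℤ._* (sign m ◃ q)) (ℤ.+◃n≡+n g) ⟩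
  + g ℤ.* (sign m ◃ q)           ∎)
  where open ≡-Reasoning

-- After division by the gcd `g`, `coprime-^` raises the first number to its `k`-th power and then,
-- with the roles exchanged, the second. Multiplication by `gᵏ` returns to `m` and `n`.
bézout-^ : ∀ k m n → ∃₂ λ P Q → P ℤ.* m ℤ.^ k ℤ.+ Q ℤ.* n ℤ.^ k ≡ (+ gcd ∣ m ∣ ∣ n ∣) ℤ.^ k
bézout-^ k m n = go (gcd ∣ m ∣ ∣ n ∣) refl
  where
  go : ∀ g → gcd ∣ m ∣ ∣ n ∣ ≡ g → ∃₂ λ P Q → P ℤ.* m ℤ.^ k ℤ.+ Q ℤ.* n ℤ.^ k ≡ (+ g) ℤ.^ k
  -- A vanishing gcd forces `m = 0`, so both sides are `0ᵏ`, also for `k = 0`.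
  go zero eq = 1ℤ , 0ℤ , (begin
    1ℤ ℤ.* m ℤ.^ k ℤ.+ 0ℤ ℤ.* n ℤ.^ k   ≡⟨ drop (m ℤ.^ k) (n ℤ.^ k) ⟩
    m ℤ.^ k                            ≡⟨ cong (ℤ._^ k) (ℤ.∣i∣≡0⇒i≡0 (gcd[m,n]≡0⇒m≡0 eq)) ⟩
    0ℤ ℤ.^ k                           ∎)
    where
    open ≡-Reasoning
    drop : ∀ u v → 1ℤ ℤ.* u ℤ.+ 0ℤ ℤ.* v ≡ u
    drop = solve-∀
  go g@(suc _) eq with bézoutℤ m n | ∣-quotient m (subst (_∣ ∣ m ∣) eq (gcd[m,n]∣m ∣ m ∣ ∣ n ∣))
                                   | ∣-quotient n (subst (_∣ ∣ n ∣) eq (gcd[m,n]∣n ∣ m ∣ ∣ n ∣))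
  ... | p , r , pr | a , m≡ | b , n≡ =
    let P , Q , P≡ = coprime-^ k {p} {r} {a} {b} coprime
        R , S , ≡1 = coprime-^ k {Q} {P} {b} {a ℤ.^ k} (trans (ℤ.+-comm (Q ℤ.* b) (P ℤ.* a ℤ.^ k)) P≡)
    in S , R , (begin
      S ℤ.* m ℤ.^ k ℤ.+ R ℤ.* n ℤ.^ k                       ≡⟨ cong₂ (λ u v → S ℤ.* u ℤ.^ k ℤ.+ R ℤ.* v ℤ.^ k) m≡ n≡ ⟩
      S ℤ.* (+ g ℤ.* a) ℤ.^ k ℤ.+ R ℤ.* (+ g ℤ.* b) ℤ.^ k   ≡⟨ cong₂ (λ u v → S ℤ.* u ℤ.+ R ℤ.* v) (^-distribʳ-* k (+ g) a) (^-distribʳ-* k (+ g) b) ⟩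
      S ℤ.* (G ℤ.* a ℤ.^ k) ℤ.+ R ℤ.* (G ℤ.* b ℤ.^ k)       ≡⟨ factor G R S (a ℤ.^ k) (b ℤ.^ k) ⟩
      G ℤ.* (R ℤ.* b ℤ.^ k ℤ.+ S ℤ.* a ℤ.^ k)               ≡⟨ cong (G ℤ.*_) ≡1 ⟩
      G ℤ.* 1ℤ                                              ≡⟨ ℤ.*-identityʳ G ⟩
      G                                                     ∎)
    where
    open ≡-Reasoning
    G = (+ g) ℤ.^ k
    factor : ∀ G R S u v → S ℤ.* (G ℤ.* u) ℤ.+ R ℤ.* (G ℤ.* v) ≡ G ℤ.* (R ℤ.* v ℤ.+ S ℤ.* u)
    factor = solve-∀
    factor′ : ∀ g p a r b → g ℤ.* (p ℤ.* a ℤ.+ r ℤ.* b) ≡ p ℤ.* (g ℤ.* a) ℤ.+ r ℤ.* (g ℤ.* b)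
    factor′ = solve-∀
    coprime : p ℤ.* a ℤ.+ r ℤ.* b ≡ 1ℤ
    coprime = ℤ.*-cancelˡ-≡ (+ g) _ _ (begin
      + g ℤ.* (p ℤ.* a ℤ.+ r ℤ.* b)              ≡⟨ factor′ (+ g) p a r b ⟩
      p ℤ.* (+ g ℤ.* a) ℤ.+ r ℤ.* (+ g ℤ.* b)     ≡⟨ cong₂ (λ u v → p ℤ.* u ℤ.+ r ℤ.* v) m≡ n≡ ⟨
      p ℤ.* m ℤ.+ r ℤ.* n                        ≡⟨ pr ⟩
      + gcd ∣ m ∣ ∣ n ∣                          ≡⟨ cong +_ eq ⟩
      + g                                        ≡⟨ ℤ.*-identityʳ (+ g) ⟨
      + g ℤ.* 1ℤ                                 ∎)

-- The content of the tail enters as a single integer: `bézout-^` combines its power with that of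
-- the head, and `Q` scales the vector already found for the tail.
bézoutVec : ∀ k (x : Vec ℤ s) → .{{NonZero k}} → ∃[ u ] diagonalForm k u x ≡ (+ content x) ℤ.^ k
-- The empty vector has content 0, and `0ᵏ = 0` because `k` is positive.
bézoutVec (suc k) []       = [] , refl
bézoutVec k (x ∷ xs) with bézoutVec k xs | bézout-^ k x (+ content xs)
... | u , eq | P , Q , eq′ = P ∷ Vec.map (Q ℤ.*_) u ,
  trans (cong (λ f → P ℤ.* x ℤ.^ k ℤ.+ f) (trans (form-*ˡ k Q u xs) (cong (Q ℤ.*_) eq))) eq′

content-∣ : ∀ (x : Vec ℤ s) {g} → g ∣ content x → ∃[ y ] x ≡ Vec.map (+ g ℤ.*_) y
content-∣ []       _  = [] , refl
content-∣ (x ∷ xs) g∣ with ∣-quotient x (∣.∣-trans g∣ (gcd[m,n]∣m ∣ x ∣ (content xs)))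
                         | content-∣ xs (∣.∣-trans g∣ (gcd[m,n]∣n ∣ x ∣ (content xs)))
... | y , eq | ys , eqs = y ∷ ys , cong₂ _∷_ eq eqs

content-* : ∀ g (x : Vec ℤ s) → content (Vec.map (+ g ℤ.*_) x) ≡ g * content x
content-* g []       = sym (ℕ.*-zeroʳ g)
content-* g (x ∷ xs) = trans (cong₂ gcd (ℤ.abs-* (+ g) x) (content-* g xs))
                             (sym (c*gcd[m,n]≡gcd[cm,cn] g ∣ x ∣ (content xs)))

-- Primitive zeros.

PrimitiveZero : ℕ → Vec ℤ s → Vec ℤ s → Set
PrimitiveZero k a x = diagonalForm k a x ≡ 0ℤ × content x ≡ 1

-- The form is homogeneous of degree `k`, so dividing `x` by its content `g` changes the value only
-- by the factor `gᵏ`. This factor is nonzero, as `g = 0` would give `‖ x ‖ = 0`.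
primitiveZero : ∀ k (a x : Vec ℤ s) → diagonalForm k a x ≡ 0ℤ → 0 < ‖ x ‖ →
  ∃[ y ] (PrimitiveZero k a y × 0 < ‖ y ‖ × ‖ y ‖ ≤ ‖ x ‖)
primitiveZero k a x ax≡0 0<x = go (content x) refl (content-∣ x ∣.∣-refl)
  where
  go : ∀ g → content x ≡ g → ∃[ y ] x ≡ Vec.map (+ content x ℤ.*_) y →
       ∃[ y ] (PrimitiveZero k a y × 0 < ‖ y ‖ × ‖ y ‖ ≤ ‖ x ‖)
  go g refl (y , eq) = y , (ay≡0 , y-primitive) ,
    ℕ.n≢0⇒n>0 (λ y≡0 → ℕ.<⇒≢ 0<x (sym (trans norm (trans (cong (g *_) y≡0) (ℕ.*-zeroʳ g))))) ,
    ℕ.≤-trans (ℕ.m≤n*m ‖ y ‖ g) (ℕ.≤-reflexive (sym norm))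
    where
    norm : ‖ x ‖ ≡ g * ‖ y ‖
    norm = trans (cong ‖_‖ eq) (‖‖-* (+ g) y)
    instance
      g≢0 : NonZero g
      g≢0 = ≢-nonZero λ g≡0 → ℕ.<⇒≢ 0<x (sym (trans norm (cong (_* ‖ y ‖) g≡0)))
    y-primitive : content y ≡ 1
    y-primitive = ℕ.*-cancelˡ-≡ (content y) 1 g (trans (sym (content-* g y))
      (trans (cong content (sym eq)) (sym (ℕ.*-identityʳ g))))
    ay≡0 : diagonalForm k a y ≡ 0ℤ
    ay≡0 with ℤ.i*j≡0⇒i≡0∨j≡0 ((+ g) ℤ.^ k)
                (trans (sym (form-*ʳ k (+ g) a y)) (trans (cong (diagonalForm k a) (sym eq)) ax≡0))
    ... | inj₁ gᵏ≡0 = ⊥-elim (≢-nonZero⁻¹ g (ℤ.+-injective (ℤ.i^n≡0⇒i≡0 (+ g) k gᵏ≡0)))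
    ... | inj₂ ≡0   = ≡0

-- Small coefficient vectors with a prescribed value.

divMod : ∀ q .{{_ : NonZero q}} (v : Vec ℤ s) →
  v ≡ Vec.zipWith ℤ._+_ (Vec.map (λ z → + (z ℤ.%ℕ q)) v) (Vec.map (+ q ℤ.*_) (Vec.map (ℤ._/ℕ q) v))
divMod q []       = refl
divMod q (z ∷ zs) = cong₂ _∷_
  (trans (ℤ.a≡a%ℕn+[a/ℕn]*n z q) (cong (λ m → + (z ℤ.%ℕ q) ℤ.+ m) (ℤ.*-comm (z ℤ./ℕ q) (+ q))))
  (divMod q zs)

module _ (k X : ℕ) .{{_ : NonZero k}} .{{_ : NonZero X}} (x : Vec ℤ s) (j : Fin s) (n : ℕ) where

  private
    instance
      Xᵏ≢0 : NonZero (X ^ k)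
      Xᵏ≢0 = ℕ.m^n≢0 X k

    q : ℕ
    q = X ^ k

    w : ℤ
    w = lookup x j ℤ.^ k

    multiples remainders quotients : Vec ℤ s
    multiples  = Vec.map (+ n ℤ.*_) (proj₁ (bézoutVec k x))
    remainders = Vec.map (λ z → + (z ℤ.%ℕ q)) multiples
    quotients  = Vec.map (ℤ._/ℕ q) multiples

    carry : ℤ
    carry = diagonalForm k quotients x

  -- The multiple n u of a Bézout vector u with its coordinates reduced modulo Xᵏ;
  -- since ∣xⱼ∣ = X, the multiples of Xᵏ removed can be restored in coordinate j.
  preimage : Vec ℤ s
  preimage = remainders [ j ]%= (ℤ._+ unit w ℤ.* carry)

  module _ (content≡1 : content x ≡ 1) (max-j : ∣ lookup x j ∣ ≡ X) where

    private
      ∣w∣ : ∣ w ∣ ≡ q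
      ∣w∣ = trans (abs-^ (lookup x j) k) (cong (_^ k) max-j)

      n-split : diagonalForm k remainders x ℤ.+ + q ℤ.* carry ≡ + n
      n-split = begin
        diagonalForm k remainders x ℤ.+ + q ℤ.* carry                        ≡⟨ cong (λ f → diagonalForm k remainders x ℤ.+ f) (form-*ˡ k (+ q) quotients x) ⟨
        diagonalForm k remainders x ℤ.+ diagonalForm k (Vec.map (+ q ℤ.*_) quotients) x ≡⟨ form-+ k remainders _ x ⟨
        diagonalForm k (Vec.zipWith ℤ._+_ remainders (Vec.map (+ q ℤ.*_) quotients)) x   ≡⟨ cong (λ v → diagonalForm k v x) (divMod q multiples) ⟨
        diagonalForm k multiples x                                            ≡⟨ form-*ˡ k (+ n) (proj₁ (bézoutVec k x)) x ⟩
        + n ℤ.* diagonalForm k (proj₁ (bézoutVec k x)) x                       ≡⟨ cong (+ n ℤ.*_) (trans (proj₂ (bézoutVec k x)) (trans (cong (λ g → (+ g) ℤ.^ k) content≡1) (ℤ.^-zeroˡ k))) ⟩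
        + n ℤ.* 1ℤ                                                            ≡⟨ ℤ.*-identityʳ (+ n) ⟩
        + n                                                                   ∎
        where open ≡-Reasoning

    preimage-form : diagonalForm k preimage x ≡ + n
    preimage-form = begin
      diagonalForm k preimage x                                    ≡⟨ form-%= k remainders x j (unit w ℤ.* carry) ⟩
      diagonalForm k remainders x ℤ.+ unit w ℤ.* carry ℤ.* w        ≡⟨ cong (λ f → diagonalForm k remainders x ℤ.+ f) (swap (unit w) carry w) ⟩
      -- As `∣ w ∣ = q`, the correction contributes exactly the `q · carry` lost in the reduction,
      -- whatever the sign of `w`.
      diagonalForm k remainders x ℤ.+ unit w ℤ.* w ℤ.* carry        ≡⟨ cong (λ z → diagonalForm k remainders x ℤ.+ z ℤ.* carry) (trans (unit-* w) (cong +_ ∣w∣)) ⟩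
      diagonalForm k remainders x ℤ.+ + q ℤ.* carry                 ≡⟨ n-split ⟩
      + n                                                          ∎
      where
      open ≡-Reasoning
      swap : ∀ a b c → a ℤ.* b ℤ.* c ≡ a ℤ.* c ℤ.* b
      swap = solve-∀

    -- A Bézout vector comes with no bound on its size, so `carry` is estimated through the value
    -- instead: `q · carry = n − F`, where `F` is the form of the remainders at `x`. Here `n ≤ q M`
    -- and `∣ F ∣ ≤ s q M`, so that `q` cancels.
    ‖preimage‖≤ : ∀ {M} → ‖ x ‖ ≤ X → q ≤ M → n ≤ q * M → ‖ preimage ‖ ≤ (s + 2) * M
    ‖preimage‖≤ {M} x≤X q≤M n≤qM = begin
      ‖ preimage ‖                                ≤⟨ ‖‖-%= remainders j (unit w ℤ.* carry) ⟩
      ‖ remainders ‖ + ∣ unit w ℤ.* carry ∣       ≤⟨ ℕ.+-mono-≤ ‖r‖≤q (ℕ.≤-reflexive (trans (ℤ.abs-* (unit w) carry) (trans (cong (_* ∣ carry ∣) (∣unit∣ w)) (ℕ.*-identityˡ ∣ carry ∣)))) ⟩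
      q + ∣ carry ∣                               ≤⟨ ℕ.+-mono-≤ q≤M carry≤ ⟩
      M + (M + s * M)                             ≡⟨ collect M s ⟩
      (s + 2) * M                                 ∎
      where
      open ℕ.≤-Reasoning
      collect : ∀ M s → M + (M + s * M) ≡ (s + 2) * M
      collect = solve-∀-ℕ
      ‖r‖≤q : ‖ remainders ‖ ≤ q
      ‖r‖≤q = ‖‖-lub (λ z → ℕ.<⇒≤ (ℤ.n%ℕd<d z q)) multiples
      F = diagonalForm k remainders x
      isolate : ∀ f c → c ≡ (f ℤ.+ c) ℤ.- f
      isolate = solve-∀
      carry≤ : ∣ carry ∣ ≤ M + s * M
      carry≤ = ℕ.*-cancelˡ-≤ q (begin
        q * ∣ carry ∣                     ≡⟨ ℤ.abs-* (+ q) carry ⟨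
        ∣ + q ℤ.* carry ∣                 ≡⟨ cong ∣_∣ (trans (isolate F (+ q ℤ.* carry)) (cong (ℤ._- F) n-split)) ⟩
        ∣ + n ℤ.- F ∣                     ≤⟨ ℤ.∣i-j∣≤∣i∣+∣j∣ (+ n) F ⟩
        n + ∣ F ∣                         ≤⟨ ℕ.+-mono-≤ n≤qM (∣form∣≤ k remainders x) ⟩
        q * M + s * (‖ remainders ‖ * ‖ x ‖ ^ k) ≤⟨ ℕ.+-monoʳ-≤ (q * M) (ℕ.*-monoʳ-≤ s (ℕ.*-mono-≤ (ℕ.≤-trans ‖r‖≤q q≤M) (ℕ.^-monoˡ-≤ k x≤X))) ⟩
        q * M + s * (M * q)               ≡⟨ factor q M s ⟩
        q * (M + s * M)                   ∎)
        where
        factor : ∀ q M s → q * M + s * (M * q) ≡ q * (M + s * M)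
        factor = solve-∀-ℕ

-- Injective coding of boxes.

signCode : Sign → Fin 2
signCode Sign.+ = Fin.zero
signCode Sign.- = Fin.suc Fin.zero

signCode-injective : ∀ {σ τ} → signCode σ ≡ signCode τ → σ ≡ τ
signCode-injective {Sign.+} {Sign.+} _ = refl
signCode-injective {Sign.-} {Sign.-} _ = refl

-- Coding each coordinate by sign and absolute value provides slightly more codes than integers,
-- which affects only the constant. The norm bound is an irrelevant argument, so the code depends on
-- the vector alone.
boxCode : ∀ {n} (x : Vec ℤ s) → .(‖ x ‖ < n) → Fin ((2 * n) ^ s)
boxCode []       _   = Fin.zero
boxCode (x ∷ xs) x<n = Fin.combine
  (Fin.combine (signCode (sign x)) (Fin.fromℕ< (ℕ.m⊔n<o⇒m<o ∣ x ∣ ‖ xs ‖ x<n)))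
  (boxCode xs (ℕ.m⊔n<o⇒n<o ∣ x ∣ ‖ xs ‖ x<n))

boxCode-injective : ∀ {n} (x y : Vec ℤ s) .(x<n : ‖ x ‖ < n) .(y<n : ‖ y ‖ < n) →
  boxCode x x<n ≡ boxCode y y<n → x ≡ y
boxCode-injective []       []       _   _   _  = refl
boxCode-injective {suc s} {n} (x ∷ xs) (y ∷ ys) x<n y<n eq =
  let head≡ , tail≡ = Fin.combine-injective {2 * n} {(2 * n) ^ s} _ _ _ _ eq
      sign≡ , abs≡  = Fin.combine-injective {2} {n} _ _ _ _ head≡
  in cong₂ _∷_ (ℤ.◃-cong (signCode-injective sign≡) (Fin.fromℕ<-injective _ _ _ _ abs≡))
               (boxCode-injective xs ys _ _ tail≡)

-- Counting the coefficient vectors that have a primitive zero of given norm.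

lookup-injective : ∀ {A : Set} {xs : List A} → Unique xs → ∀ {i j} →
  List.lookup xs i ≡ List.lookup xs j → i ≡ j
lookup-injective (_  ∷ _)  {Fin.zero}  {Fin.zero}  _  = refl
lookup-injective (x∉ ∷ _)  {Fin.zero}  {Fin.suc j} eq = ⊥-elim (Allᴸ.lookup x∉ (∈-lookup j) eq)
lookup-injective (x∉ ∷ _)  {Fin.suc i} {Fin.zero}  eq = ⊥-elim (Allᴸ.lookup x∉ (∈-lookup i) (sym eq))
lookup-injective (_  ∷ us) {Fin.suc i} {Fin.suc j} eq = cong Fin.suc (lookup-injective us eq)

injective₃⇒≤ : ∀ {l m n b} (f : Fin l → Fin m → Fin n → Fin b) →
  (∀ {i i′ t t′ r r′} → f i t r ≡ f i′ t′ r′ → i ≡ i′ × t ≡ t′ × r ≡ r′) → l * (m * n) ≤ b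
injective₃⇒≤ {l} {m} {n} {b} f f-injective = Fin.injective⇒≤ {f = g} g-injective
  where
  split : Fin (l * (m * n)) → Fin l × Fin m × Fin n
  split z = let i , y = Fin.remQuot {l} (m * n) z in i , Fin.remQuot {m} n y
  g : Fin (l * (m * n)) → Fin b
  g z = let i , t , r = split z in f i t r
  merge : Fin l × Fin m × Fin n → Fin (l * (m * n))
  merge (i , t , r) = Fin.combine i (Fin.combine t r)
  merge-split : ∀ z → merge (split z) ≡ z
  merge-split z = let i , y = Fin.remQuot {l} (m * n) z in
    trans (cong (Fin.combine i) (Fin.combine-remQuot {m} n y)) (Fin.combine-remQuot {l} (m * n) z)
  g-injective : Injective _≡_ _≡_ g
  g-injective {z} {z′} eq = let i≡ , t≡ , r≡ = f-injective eq in
    trans (sym (merge-split z))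
      (trans (cong merge (cong₂ _,_ i≡ (cong₂ _,_ t≡ r≡))) (merge-split z′))

-- The overwritten coordinate is restored from its sign and absolute value, and the value written is
-- read off at `j`.
≔-determines : ∀ {j j′} (x x′ : Vec ℤ s) {y y′} → j ≡ j′ →
  sign (lookup x j) ≡ sign (lookup x′ j′) → ∣ lookup x j ∣ ≡ ∣ lookup x′ j′ ∣ →
  x [ j ]≔ y ≡ x′ [ j′ ]≔ y′ → x ≡ x′ × y ≡ y′
≔-determines {j = j} x x′ {y} {y′} refl sign≡ abs≡ eq =
  (begin
    x                                  ≡⟨ Vec.[]≔-lookup x j ⟨
    x [ j ]≔ lookup x j                ≡⟨ Vec.[]≔-idempotent x j ⟨
    (x [ j ]≔ y) [ j ]≔ lookup x j     ≡⟨ cong₂ (_[ j ]≔_) eq (ℤ.◃-cong sign≡ abs≡) ⟩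
    (x′ [ j ]≔ y′) [ j ]≔ lookup x′ j  ≡⟨ Vec.[]≔-idempotent x′ j ⟩
    x′ [ j ]≔ lookup x′ j              ≡⟨ Vec.[]≔-lookup x′ j ⟩
    x′                                 ∎) ,
  trans (sym (Vec.lookup∘update j x y)) (trans (cong (λ v → lookup v j) eq) (Vec.lookup∘update j x′ y′))
  where open ≡-Reasoning

-- Evaluating the forms of the two equal translates at the common `x` gives `n` and `n′`. Once these
-- agree, both translations are by the same `preimage`, which cancels.
translate-determines : ∀ k X .{{_ : NonZero k}} .{{_ : NonZero X}} {x x′ a a′ : Vec ℤ s} {j j′ n n′} →
  x ≡ x′ → j ≡ j′ → PrimitiveZero k a x → PrimitiveZero k a′ x′ → ∣ lookup x j ∣ ≡ X →
  Vec.zipWith ℤ._+_ a (preimage k X x j n) ≡ Vec.zipWith ℤ._+_ a′ (preimage k X x′ j′ n′) →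
  a ≡ a′ × n ≡ n′
translate-determines k X {x} {a = a} {a′} {j} {n = n} {n′} refl refl (ax≡0 , prim) (a′x≡0 , _) max-j eq
  with ℤ.+-injective (trans (sym (value {a} {n} ax≡0)) (trans (cong (λ b → diagonalForm k b x) eq) (value {a′} {n′} a′x≡0)))
  where
  value : ∀ {a n} → diagonalForm k a x ≡ 0ℤ →
    diagonalForm k (Vec.zipWith ℤ._+_ a (preimage k X x j n)) x ≡ + n
  value {a} {n} ax≡0 = trans (form-+ k a (preimage k X x j n) x)
    (trans (cong₂ ℤ._+_ ax≡0 (preimage-form k X x j n prim max-j)) (ℤ.+-identityˡ (+ n)))
... | refl = +-cancelʳ a a′ (preimage k X x j n) eq , refl

-- The left side counts triples of an index into `as`, a value `t < XᵏM` and a value `r < X`. The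
-- right side counts codes made of `j`, the sign of `xⱼ`, the vector `cleared r` and the vector
-- `translate t`.
fibre-count : ∀ k X M .{{_ : NonZero k}} .{{_ : NonZero X}} → X ^ k ≤ M →
  (as : List (Vec ℤ (suc s))) → Unique as →
  Allᴸ.All (λ a → ‖ a ‖ ≤ M × ∃[ x ] (PrimitiveZero k a x × ‖ x ‖ ≡ X)) as →
  List.length as * (X ^ k * M * X) ≤
    suc s * (2 * ((2 * suc X) ^ suc s * (2 * suc ((suc s + 3) * M)) ^ suc s))
fibre-count {s} k X M Xᵏ≤M as unique witnesses = injective₃⇒≤ code code-injective
  where
  module _ (i : Fin (List.length as)) where
    a : Vec ℤ (suc s)
    a = List.lookup as i
    witness : ‖ a ‖ ≤ M × ∃[ x ] (PrimitiveZero k a x × ‖ x ‖ ≡ X)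
    witness = Allᴸ.lookup witnesses (∈-lookup i)
    x : Vec ℤ (suc s)
    x = proj₁ (proj₂ witness)
    zero-x : PrimitiveZero k a x
    zero-x = proj₁ (proj₂ (proj₂ witness))
    ‖x‖≡X : ‖ x ‖ ≡ X
    ‖x‖≡X = proj₂ (proj₂ (proj₂ witness))
    j : Fin (suc s)
    j = proj₁ (argmax x)
    max-j : ∣ lookup x j ∣ ≡ X
    max-j = trans (proj₂ (argmax x)) ‖x‖≡X
    -- Overwriting xⱼ = ±X by a free value r < X saves a factor X in the count of x:
    -- x is recovered from j, the sign of xⱼ and any one of these vectors.
    cleared : Fin X → Vec ℤ (suc s)
    cleared r = x [ j ]≔ + Fin.toℕ r
    ‖cleared‖ : ∀ r → ‖ cleared r ‖ < suc X
    ‖cleared‖ r = s≤s (‖‖-≔ x j (ℕ.≤-reflexive ‖x‖≡X) (ℕ.<⇒≤ (Fin.toℕ<n r)))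
    translate : Fin (X ^ k * M) → Vec ℤ (suc s)
    translate t = Vec.zipWith ℤ._+_ a (preimage k X x j (Fin.toℕ t))
    ‖translate‖ : ∀ t → ‖ translate t ‖ < suc ((suc s + 3) * M)
    ‖translate‖ t = s≤s (begin
      ‖ translate t ‖                       ≤⟨ ‖‖-+ a (preimage k X x j (Fin.toℕ t)) ⟩
      ‖ a ‖ + _                             ≤⟨ ℕ.+-mono-≤ (proj₁ witness)
                                                 (‖preimage‖≤ k X x j (Fin.toℕ t) (proj₂ zero-x) max-j
                                                   (ℕ.≤-reflexive ‖x‖≡X) Xᵏ≤M (ℕ.<⇒≤ (Fin.toℕ<n t))) ⟩
      M + (suc s + 2) * M                   ≡⟨ collect M s ⟩
      (suc s + 3) * M                       ∎)
      where
      open ℕ.≤-Reasoning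
      collect : ∀ M s → M + (suc s + 2) * M ≡ (suc s + 3) * M
      collect = solve-∀-ℕ
    code : Fin (X ^ k * M) → Fin X →
      Fin (suc s * (2 * ((2 * suc X) ^ suc s * (2 * suc ((suc s + 3) * M)) ^ suc s)))
    code t r = Fin.combine j (Fin.combine (signCode (sign (lookup x j)))
      (Fin.combine (boxCode (cleared r) (‖cleared‖ r)) (boxCode (translate t) (‖translate‖ t))))
  code-injective : ∀ {i i′ t t′ r r′} → code i t r ≡ code i′ t′ r′ → i ≡ i′ × t ≡ t′ × r ≡ r′
  code-injective {i} {i′} {t} {t′} {r} {r′} eq =
    let j≡ , eq₁ = Fin.combine-injective (j i) _ (j i′) _ eq
        sign≡ , eq₂ = Fin.combine-injective (signCode (sign (lookup (x i) (j i)))) _ _ _ eq₁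
        cleared≡ , translate≡ = Fin.combine-injective (boxCode (cleared i r) (‖cleared‖ i r)) _ _ _ eq₂
        x≡ , r≡ = ≔-determines (x i) (x i′) j≡ (signCode-injective sign≡)
                    (trans (max-j i) (sym (max-j i′)))
                    (boxCode-injective (cleared i r) (cleared i′ r′) _ _ cleared≡)
        -- The translation depends on `x` and `j`, so these are recovered before `a` and `t`.
        a≡ , t≡ = translate-determines k X x≡ j≡ (zero-x i) (zero-x i′) (max-j i)
                    (boxCode-injective (translate i t) (translate i′ t′) _ _ translate≡)
    in lookup-injective unique a≡ , Fin.toℕ-injective t≡ , Fin.toℕ-injective (ℤ.+-injective r≡)

-- Summation over the norms of the zeros.

split-⊎ : ∀ {A : Set} {P Q : A → Set} {xs : List A} → Allᴸ.All (λ x → P x ⊎ Q x) xs →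
  ∃₂ λ ys zs → (ys ⊆ xs × Allᴸ.All P ys) × (zs ⊆ xs × Allᴸ.All Q zs) ×
               List.length xs ≡ List.length ys + List.length zs
split-⊎ Allᴸ.[] = [] , [] , ([] , Allᴸ.[]) , ([] , Allᴸ.[]) , refl
split-⊎ {xs = x ∷ _} (pq Allᴸ.∷ pqs) with split-⊎ pqs | pq
... | ys , zs , (σ , ps) , (τ , qs) , eq | inj₁ p =
  x ∷ ys , zs , (refl ∷ σ , p Allᴸ.∷ ps) , (x ∷ʳ τ , qs) , cong suc eq
... | ys , zs , (σ , ps) , (τ , qs) , eq | inj₂ q =
  ys , x ∷ zs , (x ∷ʳ σ , ps) , (refl ∷ τ , q Allᴸ.∷ qs) , trans (cong suc eq) (sym (ℕ.+-suc _ _))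

Unique-resp-⊇ : ∀ {A : Set} {xs ys : List A} → ys ⊆ xs → Unique xs → Unique ys
Unique-resp-⊇ []         []        = []
Unique-resp-⊇ (_ ∷ʳ τ)   (_  ∷ us) = Unique-resp-⊇ τ us
Unique-resp-⊇ (refl ∷ τ) (x∉ ∷ us) = All-resp-⊆ τ x∉ ∷ Unique-resp-⊇ τ us

-- Union bound, splitting off the top value `suc N` each time. An entry may lie in several fibres;
-- its own witness decides where it is counted, so `P` may be undecidable.
sum-fibres : ∀ {A : Set} (P : ℕ → A → Set) {m b} N →
  (∀ n → 0 < n → n ≤ N → ∀ xs → Unique xs → Allᴸ.All (P n) xs → List.length xs * m ≤ b) →
  ∀ xs → Unique xs → Allᴸ.All (λ x → ∃[ n ] (0 < n × n ≤ N × P n x)) xs → List.length xs * m ≤ N * b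
sum-fibres P zero    _ []       _ _ = z≤n
sum-fibres P zero    _ (x ∷ xs) _ ((n , 0<n , n≤0 , _) Allᴸ.∷ _) = ⊥-elim (ℕ.<⇒≱ 0<n n≤0)
sum-fibres P {m} {b} (suc N) fibre xs unique witnesses
  with split-⊎ (Allᴸ.map top-or-below witnesses)
  where
  top-or-below : ∀ {x} → ∃[ n ] (0 < n × n ≤ suc N × P n x) →
    P (suc N) x ⊎ ∃[ n ] (0 < n × n ≤ N × P n x)
  top-or-below (n , 0<n , n≤ , p) with ℕ.m≤n⇒m<n∨m≡n n≤
  ... | inj₁ n<   = inj₂ (n , 0<n , ℕ.≤-pred n< , p)
  ... | inj₂ refl = inj₁ p
... | ys , zs , (σ , ps) , (τ , qs) , eq = begin
  List.length xs * m                          ≡⟨ cong (_* m) eq ⟩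
  (List.length ys + List.length zs) * m       ≡⟨ ℕ.*-distribʳ-+ m (List.length ys) _ ⟩
  List.length ys * m + List.length zs * m     ≤⟨ ℕ.+-mono-≤
      (fibre (suc N) (s≤s z≤n) ℕ.≤-refl ys (Unique-resp-⊇ σ unique) ps)
      (sum-fibres P N (λ n 0<n n≤N → fibre n 0<n (ℕ.m≤n⇒m≤1+n n≤N)) zs (Unique-resp-⊇ τ unique) qs) ⟩
  suc N * b                                   ∎
  where open ℕ.≤-Reasoning

-- s choices of j, 2 of the sign of xⱼ, and the two boxes of fibre-count,
-- whose sides are at most 4X and 2(s + 4)M.
constant : ℕ → ℕ
constant s = s * (2 * (4 ^ s * (2 * (s + 4)) ^ s))

constant>0 : ∀ s → 0 < constant (suc s)
constant>0 s = ℕ.*-mono-≤ (s≤s (z≤n {s})) (ℕ.*-mono-≤ (s≤s (z≤n {1}))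
  (ℕ.*-mono-≤ (ℕ.m^n>0 4 (suc s)) (ℕ.m^n>0 (2 * (suc s + 4)) (suc s))))

-- Since `suc s = k + suc e`, the power `X ^ suc s` contains the factor `Xᵏ X` from the left side of
-- `fibre-count`; cancelling it leaves `Xᵉ`.
fibre-bound : ∀ k e X M .{{_ : NonZero k}} .{{_ : NonZero X}} .{{_ : NonZero M}} →
  suc s ≡ k + suc e → X ^ k ≤ M →
  (as : List (Vec ℤ (suc s))) → Unique as →
  Allᴸ.All (λ a → ‖ a ‖ ≤ M × ∃[ x ] (PrimitiveZero k a x × ‖ x ‖ ≡ X)) as →
  List.length as * M ≤ constant (suc s) * (X ^ e * M ^ suc s)
fibre-bound {s} k e X M s≡ Xᵏ≤M as unique witnesses =
  ℕ.*-cancelˡ-≤ (X ^ k * X) {{ℕ.m*n≢0 (X ^ k) X {{ℕ.m^n≢0 X k}}}} (begin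
    X ^ k * X * (L * M)                                          ≡⟨ regroup (X ^ k) X L M ⟩
    L * (X ^ k * M * X)                                          ≤⟨ fibre-count k X M Xᵏ≤M as unique witnesses ⟩
    S * (2 * ((2 * suc X) ^ S * (2 * suc ((S + 3) * M)) ^ S))    ≤⟨ ℕ.*-monoʳ-≤ S (ℕ.*-monoʳ-≤ 2 (ℕ.*-mono-≤ (ℕ.^-monoˡ-≤ S X-bound) (ℕ.^-monoˡ-≤ S M-bound))) ⟩
    S * (2 * ((4 * X) ^ S * (2 * (S + 4) * M) ^ S))              ≡⟨ cong₂ (λ u v → S * (2 * (u * v))) (^-distrib-* 4 X S) (^-distrib-* (2 * (S + 4)) M S) ⟩
    S * (2 * (4 ^ S * X ^ S * ((2 * (S + 4)) ^ S * M ^ S)))      ≡⟨ cong (λ u → S * (2 * (4 ^ S * u * ((2 * (S + 4)) ^ S * M ^ S)))) (trans (cong (X ^_) s≡) (ℕ.^-distribˡ-+-* X k (suc e))) ⟩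
    S * (2 * (4 ^ S * (X ^ k * (X * X ^ e)) * ((2 * (S + 4)) ^ S * M ^ S)))  ≡⟨ collect S (4 ^ S) ((2 * (S + 4)) ^ S) (X ^ k) X (X ^ e) (M ^ S) ⟩
    X ^ k * X * (constant S * (X ^ e * M ^ S))                   ∎)
  where
  open ℕ.≤-Reasoning
  L = List.length as
  S = suc s
  regroup : ∀ q x l m → q * x * (l * m) ≡ l * (q * m * x)
  regroup = solve-∀-ℕ
  collect : ∀ s a b q x y z → s * (2 * (a * (q * (x * y)) * (b * z))) ≡ q * x * (s * (2 * (a * b)) * (y * z))
  collect = solve-∀-ℕ
  X-bound : 2 * suc X ≤ 4 * X
  X-bound = begin
    2 * (1 + X)    ≤⟨ ℕ.*-monoʳ-≤ 2 (ℕ.+-monoˡ-≤ X (>-nonZero⁻¹ X)) ⟩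
    2 * (X + X)    ≡⟨ double X ⟩
    4 * X          ∎
    where
    double : ∀ x → 2 * (x + x) ≡ 4 * x
    double = solve-∀-ℕ
  M-bound : 2 * suc ((S + 3) * M) ≤ 2 * (S + 4) * M
  M-bound = begin
    2 * (1 + (S + 3) * M)   ≤⟨ ℕ.*-monoʳ-≤ 2 (ℕ.+-monoˡ-≤ _ (>-nonZero⁻¹ M)) ⟩
    2 * (M + (S + 3) * M)   ≡⟨ absorb S M ⟩
    2 * (S + 4) * M         ∎
    where
    absorb : ∀ s m → 2 * (m + (s + 3) * m) ≡ 2 * (s + 4) * m
    absorb = solve-∀-ℕ

^-cancelˡ-≤ : ∀ {m n} d → m ^ suc d ≤ n ^ suc d → m ≤ n
^-cancelˡ-≤ d mᵈ≤nᵈ = ℕ.≮⇒≥ λ n<m → ℕ.<⇒≱ (ℕ.^-monoˡ-< (suc d) n<m) mᵈ≤nᵈ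

-- With `d = suc e`, the condition `(D ‖ x ‖)ᵈ ≤ M` expresses `‖ x ‖ ≤ M^(1/d) / D` without real
-- roots. Each of the `N` norms contributes at most `constant (suc s) * N ^ e * M ^ s`, and
-- `(D N)ᵈ ≤ M` turns the sum into a saving of `Dᵈ`.
count : ∀ k e D M .{{_ : NonZero k}} .{{_ : NonZero D}} .{{_ : NonZero M}} →
  suc s ≡ k + suc e → k ≤ suc e →
  (as : List (Vec ℤ (suc s))) → Unique as →
  Allᴸ.All (λ a → ‖ a ‖ ≤ M ×
    ∃[ x ] (diagonalForm k a x ≡ 0ℤ × 0 < ‖ x ‖ × (D * ‖ x ‖) ^ suc e ≤ M)) as →
  List.length as * D ^ suc e ≤ constant (suc s) * M ^ suc s
count {s} k e D M s≡ k≤d as unique witnesses = ℕ.*-cancelˡ-≤ M (begin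
  M * (L * D ^ d)                          ≡⟨ regroup M L (D ^ d) ⟩
  D ^ d * (L * M)                          ≤⟨ ℕ.*-monoʳ-≤ (D ^ d) (sum-fibres Fibre N fibre as unique (Allᴸ.map (λ {a} → normalise a) witnesses)) ⟩
  D ^ d * (N * (C * (N ^ e * M ^ suc s)))  ≡⟨ collect (D ^ d) N C (N ^ e) (M ^ suc s) ⟩
  D ^ d * N ^ d * (C * M ^ suc s)          ≤⟨ ℕ.*-monoˡ-≤ (C * M ^ suc s) (ℕ.≤-trans (ℕ.≤-reflexive (sym (^-distrib-* D N d))) DN-bound) ⟩
  M * (C * M ^ suc s)                      ∎)
  where
  open ℕ.≤-Reasoning
  d = suc e
  L = List.length as
  C = constant (suc s)
  n = floorRoot d M
  -- The largest `X` with `(D X)ᵈ ≤ M`.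
  N = n / D
  Fibre : ℕ → Vec ℤ (suc s) → Set
  Fibre X a = ‖ a ‖ ≤ M × ∃[ x ] (PrimitiveZero k a x × ‖ x ‖ ≡ X)
  regroup : ∀ m l p → m * (l * p) ≡ p * (l * m)
  regroup = solve-∀-ℕ
  collect : ∀ p n c q m → p * (n * (c * (q * m))) ≡ p * (n * q) * (c * m)
  collect = solve-∀-ℕ
  DN-bound : (D * N) ^ d ≤ M
  DN-bound = ℕ.≤-trans
    (ℕ.^-monoˡ-≤ d (ℕ.≤-trans (ℕ.≤-reflexive (ℕ.*-comm D N)) (ℕ.m/n*n≤m n D)))
    (searchRoot-≤ e M M)
  fibre : ∀ X → 0 < X → X ≤ N → ∀ as → Unique as → Allᴸ.All (Fibre X) as →
    List.length as * M ≤ C * (N ^ e * M ^ suc s)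
  fibre X 0<X X≤N as unique witnesses = ℕ.≤-trans
    (fibre-bound k e X M s≡ Xᵏ≤M as unique witnesses)
    (ℕ.*-monoʳ-≤ C (ℕ.*-monoˡ-≤ (M ^ suc s) (ℕ.^-monoˡ-≤ e X≤N)))
    where
    instance
      X≢0 : NonZero X
      X≢0 = >-nonZero 0<X
    Xᵏ≤M : X ^ k ≤ M
    Xᵏ≤M = begin
      -- Here `k ≤ d`, that is `2k ≤ s`, enters: it makes the modulus `Xᵏ` at most `M`.
      X ^ k        ≤⟨ ℕ.^-monoʳ-≤ X k≤d ⟩
      X ^ d        ≤⟨ ℕ.^-monoˡ-≤ d (ℕ.≤-trans X≤N (ℕ.m≤n*m N D)) ⟩
      (D * N) ^ d  ≤⟨ DN-bound ⟩
      M            ∎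
  normalise : ∀ a → ‖ a ‖ ≤ M ×
    ∃[ x ] (diagonalForm k a x ≡ 0ℤ × 0 < ‖ x ‖ × (D * ‖ x ‖) ^ d ≤ M) →
    ∃[ X ] (0 < X × X ≤ N × Fibre X a)
  normalise a (a≤M , x , ax≡0 , 0<x , Dx≤) =
    let y , zero-y , 0<y , y≤x = primitiveZero k a x ax≡0 0<x
    in ‖ y ‖ , 0<y , ℕ.≤-trans y≤x x≤N , a≤M , y , zero-y , refl
    where
    D‖x‖≤n : D * ‖ x ‖ ≤ n
    D‖x‖≤n = ℕ.≮⇒≥ λ n<Dx → ℕ.<⇒≱ (floorRoot-< e M) (ℕ.≤-trans (ℕ.^-monoˡ-≤ d n<Dx) Dx≤)
    x≤N : ‖ x ‖ ≤ N
    x≤N = subst (_≤ N) (trans (cong (_/ D) (ℕ.*-comm D ‖ x ‖)) (ℕ.m*n/n≡m ‖ x ‖ D))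
                       (ℕ./-monoˡ-≤ D D‖x‖≤n)

-- From real to integral inequalities.

ι-+1 : ∀ n → ι (suc n) ≡ ι n ℚ.+ 1ℚ
ι-+1 n = /-suc n 0

-- Distinct integers differ by at least 1, so an error of ½ is harmless. This makes inequalities
-- between reals, which hold only up to a positive error, exact for natural numbers.
ι-cancel-½ : ∀ {m n} → ι m ℚ.≤ ι n ℚ.+ ½ → m ≤ n
ι-cancel-½ {m} {n} m≤n+½ = ℕ.≮⇒≥ λ n<m → ℚ.<-irrefl refl (begin-strict
  ι n ℚ.+ 1ℚ   ≡⟨ ι-+1 n ⟨
  ι (suc n)    ≤⟨ ι-mono n<m ⟩
  ι m          ≤⟨ m≤n+½ ⟩
  ι n ℚ.+ ½    <⟨ ℚ.+-monoʳ-< (ι n) ½<1 ⟩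
  ι n ℚ.+ 1ℚ   ∎)
  where
  open ℚ.≤-Reasoning
  ½<1 : ½ ℚ.< 1ℚ
  ½<1 = ℚ.*<* (ℤ.+<+ (s≤s (s≤s z≤n)))

0<½ : 0ℚ ℚ.< ½
0<½ = ℚ.positive⁻¹ ½

0<1/ : ∀ n → 0ℚ ℚ.< + 1 ℚ./ suc n
0<1/ n = ℚ.positive⁻¹ (+ 1 ℚ./ suc n) {{ℚ.normalize-pos 1 (suc n)}}

-- At a suitable index the approximation `r` of the root satisfies `rᵈ ≤ m` exactly and
-- `(D + 1) n ≤ r + h`. By `increment`, the `d`-th power of `r + h` exceeds `rᵈ` by at most
-- `h C ≤ ½`, an error that `ι-cancel-½` removes.
root-bound : ∀ D e m n → fromℕ n ≤ᴿ fromℚ (+ 1 ℚ./ suc D) *ᴿ root (suc e) m → (suc D * n) ^ suc e ≤ m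
root-bound D e m n n≤ =
  let
    B , 0<B , N₁ , r≤B  = bounded (root d m)
    C , 0<C , increment = increment 0<B d
    δ , 0<δ , δC≡½      = divide 0<½ 0<C
    N₂ , h≤δ            = archimedean δ 0<δ
    -- This `h` is at most `δ`, whence `h C ≤ ½`, and at most 1, as `increment` requires. The error
    -- `ε` below becomes `h` on multiplication by `D + 1`.
    h                   = + 1 ℚ./ suc N₂
    ε , 0<ε , εD≡h      = divide {h} {ι (suc D)} (0<1/ N₂) (0<ι D)
    N₃ , n≤             = n≤ ε 0<ε
    i                   = N₁ + N₃
    r                   = rootSeq d m i
    0≤r                 = 0≤/ (floorRoot d (m * suc i ^ d)) i
  in ι-cancel-½ (begin
    ι ((suc D * n) ^ d)                                  ≡⟨ ι-^ (suc D * n) d ⟩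
    ι (suc D * n) ^ℚ d                                   ≡⟨ cong (_^ℚ d) (ι-* (suc D) n) ⟩
    (ι (suc D) ℚ.* ι n) ^ℚ d                             ≤⟨ ^ℚ-mono (0≤* (ℚ.<⇒≤ (0<ι D)) (0≤/ n 0)) (begin
      ι (suc D) ℚ.* ι n                                    ≤⟨ ℚ.*-monoˡ-≤-nonNeg (ι (suc D)) {{ℚ.nonNegative (ℚ.<⇒≤ (0<ι D))}} (n≤ i (ℕ.m≤n+m N₃ N₁)) ⟩
      ι (suc D) ℚ.* (+ 1 ℚ./ suc D ℚ.* r ℚ.+ ε)            ≡⟨ distribute (ι (suc D)) (+ 1 ℚ./ suc D) r ε ⟩
      ι (suc D) ℚ.* (+ 1 ℚ./ suc D) ℚ.* r ℚ.+ ε ℚ.* ι (suc D) ≡⟨ cong₂ (λ u v → u ℚ.* r ℚ.+ v) (ι-/ 1 D) εD≡h ⟩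
      1ℚ ℚ.* r ℚ.+ h                                       ≡⟨ cong (ℚ._+ h) (ℚ.*-identityˡ r) ⟩
      r ℚ.+ h                                              ∎) d ⟩
    (r ℚ.+ h) ^ℚ d                                       ≤⟨ increment r h 0≤r
                                                              (subst (ℚ._≤ B) (ℚ.0≤p⇒∣p∣≡p 0≤r) (r≤B i (ℕ.m≤m+n N₁ N₃)))
                                                              (0≤/ 1 N₂) (/-mono {1} {N₂} {1} {0} (s≤s z≤n)) ⟩
    r ^ℚ d ℚ.+ h ℚ.* C                                   ≤⟨ ℚ.+-mono-≤ (rootSeq-^-≤ e m i)
                                                              (ℚ.*-monoʳ-≤-nonNeg C {{ℚ.nonNegative (ℚ.<⇒≤ 0<C)}} (h≤δ N₂ ℕ.≤-refl)) ⟩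
    ι m ℚ.+ δ ℚ.* C                                      ≡⟨ cong (ι m ℚ.+_) δC≡½ ⟩
    ι m ℚ.+ ½                                            ∎)
  where
  open ℚ.≤-Reasoning
  d = suc e
  distribute : ∀ D c r ε → D ℚ.* (c ℚ.* r ℚ.+ ε) ≡ D ℚ.* c ℚ.* r ℚ.+ ε ℚ.* D
  distribute = solve 4 (λ D c r ε → D :* (c :* r :+ ε) := D :* c :* r :+ ε :* D) refl
    where open ℚ.+-*-Solver

-- Choice of the constant and the final estimate.

maxNorm : List (Vec ℤ s) → ℕ
maxNorm = List.foldr (λ a m → ‖ a ‖ ⊔ m) 1

1≤maxNorm : ∀ (as : List (Vec ℤ s)) → 1 ≤ maxNorm as
1≤maxNorm []       = s≤s z≤n
1≤maxNorm (a ∷ as) = ℕ.≤-trans (1≤maxNorm as) (ℕ.m≤n⊔m ‖ a ‖ (maxNorm as))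

≤maxNorm : ∀ (as : List (Vec ℤ s)) → Allᴸ.All (λ a → ‖ a ‖ ≤ maxNorm as) as
≤maxNorm []       = Allᴸ.[]
≤maxNorm (a ∷ as) = ℕ.m≤m⊔n _ _ Allᴸ.∷
  Allᴸ.map (λ ≤m → ℕ.≤-trans ≤m (ℕ.m≤n⊔m ‖ a ‖ (maxNorm as))) (≤maxNorm as)

-- This replaces the real bound `A` by a natural number. Starting `maxNorm` at 1 keeps that number
-- positive for the empty list, and `1 ≤ A` covers this starting value.
maxNorm≤ᴿ : ∀ A → fromℕ 1 ≤ᴿ A → (as : List (Vec ℤ s)) →
  Allᴸ.All (λ a → fromℕ ‖ a ‖ ≤ᴿ A) as → fromℕ (maxNorm as) ≤ᴿ A
maxNorm≤ᴿ A 1≤A []       Allᴸ.[]           = 1≤A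
maxNorm≤ᴿ A 1≤A (a ∷ as) (a≤A Allᴸ.∷ as≤A) with ℕ.⊔-sel ‖ a ‖ (maxNorm as)
... | inj₁ eq = subst (λ m → fromℕ m ≤ᴿ A) (sym eq) a≤A
... | inj₂ eq = subst (λ m → fromℕ m ≤ᴿ A) (sym eq) (maxNorm≤ᴿ A 1≤A as as≤A)

-- `M = 2M − M ≤ (2α + 1) − 1`.
halve : ∀ {M α} → 1 ≤ M → ι M ℚ.≤ α ℚ.+ ½ → ι M ℚ.≤ ι 2 ℚ.* α
halve {M} {α} 1≤M M≤ = ℚ.≤-trans (ℚ.≤-reflexive (rearrange₁ (ι M)))
  (ℚ.≤-trans (ℚ.+-mono-≤ (ℚ.+-mono-≤ M≤ M≤) (ℚ.neg-antimono-≤ (ι-mono 1≤M)))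
    (ℚ.≤-reflexive (rearrange₂ α)))
  where
  open ℚ.+-*-Solver
  rearrange₁ : ∀ m → m ≡ m ℚ.+ m ℚ.- m
  rearrange₁ = solve 1 (λ m → m := m :+ m :- m) refl
  rearrange₂ : ∀ α → α ℚ.+ ½ ℚ.+ (α ℚ.+ ½) ℚ.- ι 1 ≡ ι 2 ℚ.* α
  rearrange₂ = solve 1 (λ α → α :+ con ½ :+ (α :+ con ½) :- con (ι 1) := con (ι 2) :* α) refl

-- Let `L` be the length of the list, `M` its `maxNorm` and `ε` a positive rational below `η`. With
-- `c = 1 / (D + 1)`, `count` gives `L (D + 1)ᵈ ≤ constant s * Mˢ`, hence `T 2ˢ L ≤ Mˢ` by the
-- choice of `D`. As `1/T ≤ ε` and the approximations `α` of `A` satisfy `M ≤ 2α`, it follows that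
-- `L ≤ ε αˢ`.
few-small-zeros : ∀ k s d .{{_ : NonZero k}} → k ≤ d → s ≡ k + d → (η : ℝ) → fromℕ 0 <ᴿ η →
  ∃[ c ] (fromℕ 0 <ᴿ c ×
    ((A : ℝ) → fromℕ 1 ≤ᴿ A →
      AtMost (η *ᴿ A ^ᴿ s) λ (a : Vec ℤ s) →
        All (_≢ 0ℤ) a ×
        fromℕ ‖ a ‖ ≤ᴿ A ×
        (∃[ x ] (diagonalForm k a x ≡ 0ℤ ×
                 0 < ‖ x ‖ ×
                 fromℕ ‖ x ‖ ≤ᴿ c *ᴿ root d ‖ a ‖))))
-- As `k` is positive, `k ≤ d` excludes `d = 0`, where `root` has a dummy value, and `s = k + d`
-- excludes `s = 0`.
few-small-zeros (suc _) _    zero ()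
few-small-zeros (suc _) zero _    _ ()
few-small-zeros k@(suc _) S@(suc s) d@(suc e) k≤d s≡ η (ε , 0<ε , N₁ , ε≤η) = c , 0<c , atMost
  where
  -- 1/T ≤ ε; the factor 2ˢ in D pays for using only M ≤ 2A, which avoids any
  -- continuity argument when the approximations of A are raised to the power s.
  t T D : ℕ
  t = proj₁ (archimedean ε 0<ε)
  T = suc t
  D = T * (2 ^ S * constant S)
  c : ℝ
  c = fromℚ (+ 1 ℚ./ suc D)
  0<c : fromℕ 0 <ᴿ c
  0<c = + 1 ℚ./ suc D , 0<1/ D , 0 , λ n _ → ℚ.≤-reflexive (ℚ.+-identityˡ _)
  1/T≤ε : + 1 ℚ./ T ℚ.≤ ε
  1/T≤ε = proj₂ (archimedean ε 0<ε) _ ℕ.≤-refl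
  atMost : (A : ℝ) → fromℕ 1 ≤ᴿ A → AtMost (η *ᴿ A ^ᴿ S) _
  atMost A 1≤A as unique witnesses ε′ 0<ε′ =
    let N₂ , M≤A+½ = maxNorm≤ᴿ A 1≤A as (Allᴸ.map (λ (_ , a≤A , _) → a≤A) witnesses) ½ 0<½
    in N₁ + N₂ , λ n N≤n → final n
         (ε≤η n (ℕ.m+n≤o⇒m≤o N₁ N≤n)) (M≤A+½ n (ℕ.m+n≤o⇒n≤o N₁ N≤n))
    where
    L = List.length as
    M = maxNorm as
    instance
      M≢0 : NonZero M
      M≢0 = >-nonZero (1≤maxNorm as)
    -- `root-bound` bounds `((D + 1) ‖ x ‖)ᵈ` by `‖ a ‖`; enlarging `‖ a ‖` to `M` treats all
    -- entries of the list alike.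
    counted : L * suc D ^ d ≤ constant S * M ^ S
    counted = count k e (suc D) M s≡ k≤d as unique
      (Allᴸ.zipWith (λ (a≤M , _ , _ , x , ax≡0 , 0<x , x≤) →
        a≤M , x , ax≡0 , 0<x , ℕ.≤-trans (root-bound D e _ ‖ x ‖ x≤) a≤M) (≤maxNorm as , witnesses))
    L-bound : T * (2 ^ S * L) ≤ M ^ S
    L-bound = ℕ.*-cancelˡ-≤ (constant S) {{>-nonZero (constant>0 s)}} (begin
      constant S * (T * (2 ^ S * L))   ≡⟨ regroup (constant S) T (2 ^ S) L ⟩
      -- Since `d ≥ 1`, the crude bound `D ≤ (D + 1)ᵈ` is available.
      L * D                            ≤⟨ ℕ.*-monoʳ-≤ L (ℕ.≤-trans (ℕ.n≤1+n D) (ℕ.m≤m*n (suc D) (suc D ^ e) {{ℕ.m^n≢0 (suc D) e}})) ⟩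
      L * suc D ^ d                    ≤⟨ counted ⟩
      constant S * M ^ S               ∎)
      where
      open ℕ.≤-Reasoning
      regroup : ∀ c t p l → c * (t * (p * l)) ≡ l * (t * (p * c))
      regroup = solve-∀-ℕ
    final : ∀ n → 0ℚ ℚ.+ ε ℚ.≤ seq η n → ι M ℚ.≤ seq A n ℚ.+ ½ →
      ι L ℚ.≤ seq η n ℚ.* seq (A ^ᴿ S) n ℚ.+ ε′
    final n ε≤ηₙ M≤α+½ = begin
      ι L                                        ≡⟨ ℚ.*-identityˡ (ι L) ⟨
      1ℚ ℚ.* ι L                                 ≡⟨ cong (ℚ._* ι L) (ι-/ 1 t) ⟨
      ι T ℚ.* (+ 1 ℚ./ T) ℚ.* ι L                ≡⟨ swap (ι T) (+ 1 ℚ./ T) (ι L) ⟩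
      -- The factors are compared separately: `1/T ≤ ε ≤ ηₙ` and `T L ≤ αˢ`.
      + 1 ℚ./ T ℚ.* (ι T ℚ.* ι L)                ≤⟨ *-mono (0≤/ 1 t) αˢ≥0 (ℚ.≤-trans 1/T≤ε (ℚ.≤-trans (ℚ.≤-reflexive (sym (ℚ.+-identityˡ ε))) ε≤ηₙ)) TL≤αˢ ⟩
      ηₙ ℚ.* α ^ℚ S                              ≡⟨ cong (ηₙ ℚ.*_) (seq-^ A S n) ⟨
      ηₙ ℚ.* seq (A ^ᴿ S) n                      ≡⟨ ℚ.+-identityʳ _ ⟨
      ηₙ ℚ.* seq (A ^ᴿ S) n ℚ.+ 0ℚ               ≤⟨ ℚ.+-monoʳ-≤ (ηₙ ℚ.* seq (A ^ᴿ S) n) (ℚ.<⇒≤ 0<ε′) ⟩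
      ηₙ ℚ.* seq (A ^ᴿ S) n ℚ.+ ε′               ∎
      where
      open ℚ.≤-Reasoning
      ηₙ = seq η n
      α  = seq A n
      swap : ∀ t u l → t ℚ.* u ℚ.* l ≡ u ℚ.* (t ℚ.* l)
      swap = solve 3 (λ t u l → t :* u :* l := u :* (t :* l)) refl
        where open ℚ.+-*-Solver
      pull : ∀ t p l → p ℚ.* (t ℚ.* l) ≡ t ℚ.* (p ℚ.* l)
      pull = solve 3 (λ t p l → p :* (t :* l) := t :* (p :* l)) refl
        where open ℚ.+-*-Solver
      M≤2α : ι M ℚ.≤ ι 2 ℚ.* α
      M≤2α = halve {α = α} (1≤maxNorm as) M≤α+½
      -- A single term of a Cauchy sequence carries no sign; here it follows from `0 ≤ M ≤ 2α`.
      α≥0 : 0ℚ ℚ.≤ α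
      α≥0 = ℚ.*-cancelˡ-≤-pos (ι 2) (ℚ.≤-trans (0≤/ M 0) M≤2α)
      αˢ≥0 : 0ℚ ℚ.≤ α ^ℚ S
      αˢ≥0 = ^ℚ-nonNeg α≥0 S
      TL≤αˢ : ι T ℚ.* ι L ℚ.≤ α ^ℚ S
      TL≤αˢ = ℚ.*-cancelˡ-≤-pos (ι 2 ^ℚ S) {{ℚ.positive (^ℚ-pos (0<ι 1) S)}} (begin
        ι 2 ^ℚ S ℚ.* (ι T ℚ.* ι L)          ≡⟨ pull (ι T) (ι 2 ^ℚ S) (ι L) ⟩
        ι T ℚ.* (ι 2 ^ℚ S ℚ.* ι L)          ≡⟨ cong (λ p → ι T ℚ.* (p ℚ.* ι L)) (ι-^ 2 S) ⟨
        ι T ℚ.* (ι (2 ^ S) ℚ.* ι L)         ≡⟨ trans (ι-* T (2 ^ S * L)) (cong (ι T ℚ.*_) (ι-* (2 ^ S) L)) ⟨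
        ι (T * (2 ^ S * L))                 ≤⟨ ι-mono L-bound ⟩
        ι (M ^ S)                           ≡⟨ ι-^ M S ⟩
        ι M ^ℚ S                            ≤⟨ ^ℚ-mono (0≤/ M 0) M≤2α S ⟩
        (ι 2 ℚ.* α) ^ℚ S                    ≡⟨ ^ℚ-distrib-* (ι 2) α S ⟩
        ι 2 ^ℚ S ℚ.* α ^ℚ S                 ∎)

theorem1p4 : (k s : ℕ) → 3 ≤ k → 2 * k ≤ s → (η : ℝ) → fromℕ 0 <ᴿ η →
    ∃[ c ] (fromℕ 0 <ᴿ c ×
    ((A : ℝ) → fromℕ 1 ≤ᴿ A →
    AtMost (η *ᴿ A ^ᴿ s) λ (a : Vec ℤ s) →
    All (_≢ 0ℤ) a ×
    fromℕ ‖ a ‖ ≤ᴿ A ×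
    (∃[ x ] (diagonalForm k a x ≡ 0ℤ ×
    0 < ‖ x ‖ ×
    fromℕ ‖ x ‖ ≤ᴿ c *ᴿ root (s ∸ k) ‖ a ‖))))
-- From `2k ≤ s` come both `k ≤ s ∸ k` and the exactness of the truncated subtraction.
theorem1p4 k s 3≤k 2k≤s = few-small-zeros k s (s ∸ k) {{>-nonZero (ℕ.≤-trans (s≤s z≤n) 3≤k)}}
  (ℕ.m+n≤o⇒m≤o∸n k k+k≤s) (sym (ℕ.m+[n∸m]≡n (ℕ.m+n≤o⇒m≤o k k+k≤s)))
  where
  k+k≤s : k + k ≤ s
  k+k≤s = subst (λ m → k + m ≤ s) (ℕ.+-identityʳ k) 2k≤s
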